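{- For a fixed signature $\Sigma$, the finiteness problem is polynomial time decidable: there is an algorithm which, given a finite set $\Gamma$ of ground term equations over $\Sigma$, decides in time polynomial in $|\Gamma|$ whether the algebra $\mathcal{F}_\Gamma$ is finite.
   Context: $\Sigma$ is a finite functional signature having function symbols (of positive arity) and constant symbols. $\mathcal{F}$ is the algebra of all ground terms (terms without variables) over $\Sigma$, with operations interpreted by term formation. A ground term equation is an expression $p=q$ with $p,q$ ground terms. For a finite set $\Gamma$ of such equations, $\sim_\Gamma$ is the smallest congruence on $\mathcal{F}$ containing all pairs $(p,q)$ with $p=q$ in $\Gamma$ (equivalently, $p\sim_\Gamma q$ iff $\Gamma\vdash p=q$), and $\mathcal{F}_\Gamma=\mathcal{F}/{\sim_\Gamma}$. The size $|t|$ of a ground term is the number of nodes of its syntax tree, and $|\Gamma|=\sum_{(p=q)\in\Gamma}(|p|+|q|)$. -}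

module Defs where

open import Data.Bool.Base using (Bool; true; false)
open import Data.Fin.Base using (Fin; zero; toℕ)
open import Data.List.Base as List using (List; []; _∷_)
open import Data.List.Membership.Propositional using (_∈_)
open import Data.List.Relation.Unary.Unique.Propositional using (Unique)
open import Data.Nat.Base using (ℕ; zero; suc; _+_; _*_; _^_; _≤_)
open import Data.Product.Base using (Σ-syntax; ∃-syntax; _×_; _,_)
open import Data.Vec.Base as Vec using (Vec; []; _∷_; lookup; replicate; _[_]≔_)
open import Data.Vec.Relation.Binary.Pointwise.Inductive using (Pointwise)
open import Function.Bundles using (Bijection)
open import Level using (0ℓ)
open import Relation.Binary.Bundles using (Setoid)
open import Relation.Binary.PropositionalEquality.Core using (_≡_; _≢_)
import Relation.Binary.PropositionalEquality.Properties as ≡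
open import Relation.Nullary.Decidable.Core using (Dec; does)

------------------------------------------------------------------------
-- Ground term equations

-- Symbols of arity 0 are the constant symbols; those of positive arity
-- are the function symbols.
record Signature : Set where
  field
    symbols : ℕ
    arity   : Fin symbols → ℕ

module _ (S : Signature) where
  open Signature S

  data Term : Set where
    node : (f : Fin symbols) → Vec Term (arity f) → Term

  Equation : Set
  Equation = Term × Term

  -- A finite set of equations, listed without repetition.
  record Equations : Set where
    constructor mkEquations
    field
      list   : List Equation
      unique : Unique list

module _ {S : Signature} where
  open Signature S

  mutual
    ∣_∣ : Term S → ℕ
    ∣ node f ts ∣ = suc ∣ ts ∣*

    ∣_∣* : ∀ {n} → Vec (Term S) n → ℕ
    ∣ []     ∣* = 0
    ∣ t ∷ ts ∣* = ∣ t ∣ + ∣ ts ∣*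

  size : Equations S → ℕ
  size Γ = List.sum (List.map (λ (p , q) → ∣ p ∣ + ∣ q ∣) (Equations.list Γ))

  -- The congruence ∼_Γ: being an inductive family, it is the smallest
  -- congruence containing Γ.
  data _⊢_≈_ (Γ : Equations S) : Term S → Term S → Set where
    axiom : ∀ {p q} → (p , q) ∈ Equations.list Γ → Γ ⊢ p ≈ q
    refl  : ∀ {t} → Γ ⊢ t ≈ t
    sym   : ∀ {t u} → Γ ⊢ t ≈ u → Γ ⊢ u ≈ t
    trans : ∀ {t u v} → Γ ⊢ t ≈ u → Γ ⊢ u ≈ v → Γ ⊢ t ≈ v
    cong  : ∀ {f} {ts us : Vec (Term S) (arity f)} →
            Pointwise (Γ ⊢_≈_) ts us → Γ ⊢ node f ts ≈ node f us

-- The underlying set of the algebra 𝓕_Γ; the quotient is the setoid of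
-- ground terms modulo ∼_Γ, and `cong` makes term formation an operation
-- on it.
𝓕 : {S : Signature} → Equations S → Setoid 0ℓ 0ℓ
𝓕 {S} Γ = record
  { Carrier       = Term S
  ; _≈_           = Γ ⊢_≈_
  ; isEquivalence = record { refl = refl ; sym = sym ; trans = trans }
  }

Finite : Setoid 0ℓ 0ℓ → Set
Finite A = ∃[ n ] Bijection (≡.setoid (Fin n)) A

------------------------------------------------------------------------
-- Polynomial time
--
-- The machine model is the WHILE language of N. D. Jones (Computability
-- and Complexity from a Programming Perspective, MIT Press 1997), with
-- unit-cost running time.  Every primitive acts on boundedly many
-- pointers: values may be shared but are never traversed, copied or
-- compared in one step.  Hence the problems decidable in polynomial time
-- by WHILE programs are those decidable in polynomial time by Turing
-- machines.  A conditional is included for convenience (Jones derives it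
-- from `while` at a constant-factor cost).

infixr 5 _∙_
data Tree : Set where
  nil : Tree
  _∙_ : Tree → Tree → Tree

head tail : Tree → Tree
head nil     = nil
head (x ∙ y) = x
tail nil     = nil
tail (x ∙ y) = y

-- Expressions and commands over k variables.
data Expr (k : ℕ) : Set where
  var   : Fin k → Expr k
  nil   : Expr k
  cons  : Expr k → Expr k → Expr k
  hd tl : Expr k → Expr k

infix  4 _≔_
infixr 3 _⨾_
data Command (k : ℕ) : Set where
  _≔_           : Fin k → Expr k → Command k
  _⨾_           : Command k → Command k → Command k
  if_then_else_ : Expr k → Command k → Command k → Command k
  while_loop_   : Expr k → Command k → Command k

Store : ℕ → Set
Store k = Vec Tree k

module _ {k : ℕ} where

  ⟦_⟧ : Expr k → Store k → Tree
  ⟦ var x    ⟧ σ = lookup σ x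
  ⟦ nil      ⟧ σ = nil
  ⟦ cons d e ⟧ σ = ⟦ d ⟧ σ ∙ ⟦ e ⟧ σ
  ⟦ hd e     ⟧ σ = head (⟦ e ⟧ σ)
  ⟦ tl e     ⟧ σ = tail (⟦ e ⟧ σ)

  cost : Expr k → ℕ
  cost (var x)    = 1
  cost nil        = 1
  cost (cons d e) = suc (cost d + cost e)
  cost (hd e)     = suc (cost e)
  cost (tl e)     = suc (cost e)

  -- ⟨ c , σ ⟩⇓[ n ] τ : command c started in store σ halts in store τ
  -- after n time units.  In tests, nil is false and all else is true.
  infix 4 ⟨_,_⟩⇓[_]_
  data ⟨_,_⟩⇓[_]_ : Command k → Store k → ℕ → Store k → Set where
    assign : ∀ {x e σ} →
      ⟨ x ≔ e , σ ⟩⇓[ suc (cost e) ] (σ [ x ]≔ ⟦ e ⟧ σ)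
    seq : ∀ {c d σ τ υ m n} →
      ⟨ c , σ ⟩⇓[ m ] τ → ⟨ d , τ ⟩⇓[ n ] υ →
      ⟨ c ⨾ d , σ ⟩⇓[ suc (m + n) ] υ
    if-true : ∀ {e c d σ τ n} → ⟦ e ⟧ σ ≢ nil →
      ⟨ c , σ ⟩⇓[ n ] τ →
      ⟨ if e then c else d , σ ⟩⇓[ suc (cost e + n) ] τ
    if-false : ∀ {e c d σ τ n} → ⟦ e ⟧ σ ≡ nil →
      ⟨ d , σ ⟩⇓[ n ] τ →
      ⟨ if e then c else d , σ ⟩⇓[ suc (cost e + n) ] τ
    while-true : ∀ {e c σ τ υ m n} → ⟦ e ⟧ σ ≢ nil →
      ⟨ c , σ ⟩⇓[ m ] τ → ⟨ while e loop c , τ ⟩⇓[ n ] υ →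
      ⟨ while e loop c , σ ⟩⇓[ suc (cost e + m + n) ] υ
    while-false : ∀ {e c σ} → ⟦ e ⟧ σ ≡ nil →
      ⟨ while e loop c , σ ⟩⇓[ suc (cost e) ] σ

-- Variable 0 holds the input at the start and the output at the end; the
-- auxiliary variables are initially nil.
record Program : Set where
  constructor program
  field
    auxiliary : ℕ
    body      : Command (suc auxiliary)

_on_returns_within_ : Program → Tree → Tree → ℕ → Set
program k c on x returns y within b =
  ∃[ n ] ∃[ τ ] ⟨ c , x ∷ replicate k nil ⟩⇓[ n ] τ × lookup τ zero ≡ y × n ≤ b

encodeBool : Bool → Tree
encodeBool false = nil
encodeBool true  = nil ∙ nil

-- The program runs on the encoding of an instance; the time bound is in
-- terms of the given size of the instance.  Every polynomial in n is
-- bounded by some a * (1 + n) ^ d, so this form loses no generality.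
PolynomialTimeDecidable :
  {A : Set} → (A → Tree) → (A → ℕ) → (A → Set) → Set
PolynomialTimeDecidable {A} encode ∥_∥ P =
  ∃[ prog ] ∃[ a ] ∃[ d ] ((x : A) →
    Σ[ P? ∈ Dec (P x) ]
      prog on encode x returns encodeBool (does P?) within (a * suc ∥ x ∥ ^ d))

------------------------------------------------------------------------
-- Equation sets as inputs
--
-- For a fixed signature the encoding of Γ has size linear in the size of
-- Γ: a symbol is a unary numeral of bounded length.

encodeℕ : ℕ → Tree
encodeℕ zero    = nil
encodeℕ (suc n) = nil ∙ encodeℕ n

encodeList : List Tree → Tree
encodeList []       = nil
encodeList (x ∷ xs) = x ∙ encodeList xs

module _ {S : Signature} where

  mutual
    encodeTerm : Term S → Tree
    encodeTerm (node f ts) = encodeℕ (toℕ f) ∙ encodeTerms ts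

    encodeTerms : ∀ {n} → Vec (Term S) n → Tree
    encodeTerms []       = nil
    encodeTerms (t ∷ ts) = encodeTerm t ∙ encodeTerms ts

  encodeEquations : Equations S → Tree
  encodeEquations Γ =
    encodeList (List.map (λ (p , q) → encodeTerm p ∙ encodeTerm q)
                         (Equations.list Γ))

-- Let T be the set of the subterms of Γ and of the constants of the signature,
-- and let R be the restriction to T of the congruence generated by Γ.  R is
-- the fixed point reached after at most |T|² rounds of adding the pairs of T × T
-- that follow in one step from Γ and from the pairs found so far.  Rewriting
-- a term from the leaves upwards, replacing each application that R identifies
-- with a member of T by a representative of that member, gives a normal form
-- that is invariant under ∼_Γ; hence two terms are congruent if and only if
-- their normal forms agree.
--
-- Consequently 𝓕_Γ is finite if and only if every application of a symbol to
-- members of T equals a member of T.  If so, all normal forms lie in T.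
-- Otherwise some d outside T is its own normal form, some symbol f has positive
-- arity, and d, f(d,…,d), f(f(d,…,d),…), … are distinct normal forms.  Arities are
-- fixed with the signature, so only polynomially many applications are tested.

module Submission where

open import Defs
open import Data.Bool.Base using (Bool; true; false; _∧_; _∨_) renaming (if_then_else_ to when_then_else_)
open import Data.Bool.Properties using (∨-identityʳ; ∨-zeroʳ; ∧-identityʳ; ∧-zeroʳ; ∧-assoc)
open import Data.Empty using (⊥)
open import Data.Fin.Base using (Fin; zero; suc; toℕ)
open import Data.Fin.Properties as Fin using (toℕ-injective; toℕ<n; pigeonhole)
open import Data.List.Base as List
  using (List; []; _∷_; length; foldl; foldr; filter; reverse; map; _ʳ++_; allFin; concatMap; deduplicate)
open import Data.List.Membership.Propositional using (_∈_; lose; find)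
open import Data.List.Membership.Propositional.Properties
open import Data.List.Properties using (length-filter; filter-none; length-reverse; reverse-foldr)
open import Data.List.Relation.Binary.Pointwise as Pointwise using (Pointwise; []; _∷_; decidable)
open import Data.List.Relation.Unary.All as All using (All; all?; []; _∷_)
open import Data.List.Relation.Unary.All.Properties using (¬All⇒Any¬)
open import Data.List.Relation.Unary.AllPairs using (_∷_)
open import Data.List.Relation.Unary.Any as Any using (Any; any?; here; there)
open import Data.List.Relation.Unary.Any.Properties using (lookup-index; reverse⁺; reverse⁻)
open import Data.List.Relation.Unary.Unique.DecPropositional.Properties using (deduplicate-!)
open import Data.List.Relation.Unary.Unique.Propositional using (Unique)
open import Data.Nat.Base
open import Data.Nat.Properties hiding (_≟_)
open import Data.Nat.Solver using (module +-*-Solver)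
open import Data.Product.Base using (∃-syntax; _×_; _,_; proj₁; proj₂; uncurry)
open import Data.Product.Properties using (≡-dec)
open import Data.Sum.Base as Sum using (_⊎_; inj₁; inj₂)
open import Data.Vec.Base using (Vec; []; _∷_; toList; replicate)
open import Data.Vec.Relation.Binary.Pointwise.Inductive as VecPointwise using ([]; _∷_)
open import Data.Vec.Relation.Unary.All as VecAll using ([]; _∷_)
open import Function.Base using (_∘_; id)
open import Function.Bundles using (Bijection)
open import Relation.Binary.Definitions using (DecidableEquality)
open import Relation.Binary.PropositionalEquality as ≡ using (_≡_; _≢_; refl; subst)
open import Relation.Nullary.Decidable using (Dec; does; does-≡; yes; no; map′; _×-dec_; _⊎-dec_)
open import Relation.Nullary.Negation using (¬_; contradiction)

-- Polynomial bounds

-- Kept as syntax so that constancy of a running time can be checked by computation (`isConstant`).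
-- Coefficients are natural numbers, hence every polynomial is monotone and bounds can be
-- substituted into bounds.
data Poly : Set where
  con : ℕ → Poly
  var : Poly
  _⊕_ _⊛_ _∘ₚ_ : Poly → Poly → Poly

infixl 6 _⊕_
infixl 7 _⊛_
infixr 9 _∘ₚ_

eval : Poly → ℕ → ℕ
eval (con c)  n = c
eval var      n = n
eval (p ⊕ q)  n = eval p n + eval q n
eval (p ⊛ q)  n = eval p n * eval q n
eval (p ∘ₚ q) n = eval p (eval q n)

eval-mono : ∀ p {m n} → m ≤ n → eval p m ≤ eval p n
eval-mono (con c)  m≤n = ≤-refl
eval-mono var      m≤n = m≤n
eval-mono (p ⊕ q)  m≤n = +-mono-≤ (eval-mono p m≤n) (eval-mono q m≤n)
eval-mono (p ⊛ q)  m≤n = *-mono-≤ (eval-mono p m≤n) (eval-mono q m≤n)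
eval-mono (p ∘ₚ q) m≤n = eval-mono p (eval-mono q m≤n)

^-distribʳ-* : ∀ d m n → (m * n) ^ d ≡ m ^ d * n ^ d
^-distribʳ-* zero    m n = refl
^-distribʳ-* (suc d) m n =
  ≡.trans (≡.cong (m * n *_) (^-distribʳ-* d m n)) ([m*n]*[o*p]≡[m*o]*[n*p] m n (m ^ d) (n ^ d))

eval≤monomial : ∀ p → ∃[ a ] ∃[ d ] (∀ n → eval p n ≤ a * suc n ^ d)
eval≤monomial (con c) = c , 0 , λ n → ≤-reflexive (≡.sym (*-identityʳ c))
eval≤monomial var = 1 , 1 , λ n → begin
  n                 ≤⟨ n≤1+n n ⟩
  suc n             ≡⟨ ^-identityʳ (suc n) ⟨
  suc n ^ 1         ≡⟨ *-identityˡ _ ⟨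
  1 * suc n ^ 1     ∎
  where open ≤-Reasoning
eval≤monomial (p ⊕ q) with eval≤monomial p | eval≤monomial q
... | a , d , hp | b , e , hq = a + b , d + e , λ n → begin
  eval p n + eval q n                     ≤⟨ +-mono-≤ (hp n) (hq n) ⟩
  a * suc n ^ d + b * suc n ^ e
    ≤⟨ +-mono-≤ (*-monoʳ-≤ a (^-monoʳ-≤ (suc n) (m≤m+n d e)))
                (*-monoʳ-≤ b (^-monoʳ-≤ (suc n) (m≤n+m e d))) ⟩
  a * suc n ^ (d + e) + b * suc n ^ (d + e) ≡⟨ *-distribʳ-+ (suc n ^ (d + e)) a b ⟨
  (a + b) * suc n ^ (d + e)               ∎
  where open ≤-Reasoning
eval≤monomial (p ⊛ q) with eval≤monomial p | eval≤monomial q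
... | a , d , hp | b , e , hq = a * b , d + e , λ n → begin
  eval p n * eval q n                     ≤⟨ *-mono-≤ (hp n) (hq n) ⟩
  (a * suc n ^ d) * (b * suc n ^ e)       ≡⟨ [m*n]*[o*p]≡[m*o]*[n*p] a (suc n ^ d) b (suc n ^ e) ⟩
  a * b * (suc n ^ d * suc n ^ e)         ≡⟨ ≡.cong (a * b *_) (^-distribˡ-+-* (suc n) d e) ⟨
  a * b * suc n ^ (d + e)                 ∎
  where open ≤-Reasoning
eval≤monomial (p ∘ₚ q) with eval≤monomial p | eval≤monomial q
... | a , d , hp | b , e , hq = a * suc b ^ d , e * d , λ n → begin
  eval p (eval q n)                       ≤⟨ hp (eval q n) ⟩
  a * suc (eval q n) ^ d                  ≤⟨ *-monoʳ-≤ a (^-monoˡ-≤ d (1+q≤ n)) ⟩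
  a * (suc b * suc n ^ e) ^ d             ≡⟨ ≡.cong (a *_) (^-distribʳ-* d (suc b) (suc n ^ e)) ⟩
  a * (suc b ^ d * (suc n ^ e) ^ d)       ≡⟨ *-assoc a (suc b ^ d) _ ⟨
  a * suc b ^ d * (suc n ^ e) ^ d         ≡⟨ ≡.cong (a * suc b ^ d *_) (^-*-assoc (suc n) e d) ⟩
  a * suc b ^ d * suc n ^ (e * d)         ∎
  where
  open ≤-Reasoning
  -- The extra `1` is absorbed by one more copy of `suc n ^ e`, which is at least `1`; this is the
  -- source of `suc b` in the coefficient.
  1+q≤ : ∀ n → suc (eval q n) ≤ suc b * suc n ^ e
  1+q≤ n = +-mono-≤ (m^n>0 (suc n) e) (hq n)

isConstant : Poly → Bool
isConstant (con _)  = true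
isConstant var      = false
isConstant (p ⊕ q)  = isConstant p ∧ isConstant q
isConstant (p ⊛ q)  = isConstant p ∧ isConstant q
isConstant (p ∘ₚ q) = isConstant p ∨ isConstant q

eval-constant : ∀ p → isConstant p ≡ true → ∀ m n → eval p m ≡ eval p n
eval-constant (con _)  _ m n = refl
eval-constant (p ⊕ q)  c m n with isConstant p in cp
... | true = ≡.cong₂ _+_ (eval-constant p cp m n) (eval-constant q c m n)
eval-constant (p ⊛ q)  c m n with isConstant p in cp
... | true = ≡.cong₂ _*_ (eval-constant p cp m n) (eval-constant q c m n)
eval-constant (p ∘ₚ q) c m n with isConstant p in cp
... | true  = eval-constant p cp _ _
... | false = ≡.cong (eval p) (eval-constant q c m n)

-- Polynomial-time subroutines

weight : Tree → ℕ
weight nil     = 0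
weight (x ∙ y) = suc (weight x + weight y)

infixr 5 _⊗_

-- A code fixes a set together with its encoding. One tree may encode elements of several codes, for
-- instance of `list α` and of `α ⊗ list α`; passing between such views is then a trivial program.
data Type : Set₁ where
  base : {A : Set} → (A → Tree) → Type
  _⊗_  : Type → Type → Type
  list : Type → Type

El : Type → Set
El (base {A} _) = A
El (σ ⊗ τ)      = El σ × El τ
El (list τ)     = List (El τ)

encode : (τ : Type) → El τ → Tree
encode (base e) x        = e x
encode (σ ⊗ τ)  (x , y)  = encode σ x ∙ encode τ y
encode (list τ) []       = nil
encode (list τ) (x ∷ xs) = encode τ x ∙ encode (list τ) xs

weightOf : (τ : Type) → El τ → ℕ
weightOf τ x = weight (encode τ x)

bool tree : Type
bool = base encodeBool
tree = base (λ t → t)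

X Y : Fin 2
X = zero
Y = suc zero

RunsWithin : Command 2 → Tree → Tree → Tree → Tree → ℕ → Set
RunsWithin c x s x′ s′ b = ∃[ n ] ⟨ c , x ∷ s ∷ [] ⟩⇓[ n ] (x′ ∷ s′ ∷ []) × n ≤ b

-- A command computes on variable X and uses variable Y as a stack, whose
-- contents it leaves unchanged; thus it can be run as a subroutine.
record PolyTime (σ τ : Type) (f : El σ → El τ) : Set where
  field
    code  : Command 2
    time  : Poly
    space : Poly
    runs  : ∀ x s → RunsWithin code (encode σ x) s (encode τ (f x)) s (eval time (weightOf σ x))
    small : ∀ x → weightOf τ (f x) ≤ eval space (weightOf σ x)
open PolyTime

private variable
  A B : Set
  α β ε ρ σ τ υ : Type

runs-X : ∀ e {x s} → RunsWithin (X ≔ e) x s (⟦ e ⟧ (x ∷ s ∷ [])) s (suc (cost e))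
runs-X e = _ , assign , ≤-refl

runs-Y : ∀ e {x s} → RunsWithin (Y ≔ e) x s x (⟦ e ⟧ (x ∷ s ∷ [])) (suc (cost e))
runs-Y e = _ , assign , ≤-refl

infixr 3 _runs-⨾_
_runs-⨾_ : ∀ {c d x s x′ s′ x″ s″ a b} →
  RunsWithin c x s x′ s′ a → RunsWithin d x′ s′ x″ s″ b →
  RunsWithin (c ⨾ d) x s x″ s″ (suc (a + b))
(m , c⇓ , m≤) runs-⨾ (n , d⇓ , n≤) = _ , seq c⇓ d⇓ , s≤s (+-mono-≤ m≤ n≤)

infixr 3 _⨾ₚ_
_⨾ₚ_ : Poly → Poly → Poly
p ⨾ₚ q = con 1 ⊕ (p ⊕ q)

ticks : Expr 2 → Poly
ticks e = con (suc (cost e))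

isCons : Tree → Bool
isCons nil     = false
isCons (_ ∙ _) = true

polyTime-≗ : {f g : El σ → El τ} → (∀ x → f x ≡ g x) → PolyTime σ τ f → PolyTime σ τ g
polyTime-≗ {τ = τ} f≗g pf .code  = pf .code
polyTime-≗ {τ = τ} f≗g pf .time  = pf .time
polyTime-≗ {τ = τ} f≗g pf .space = pf .space
polyTime-≗ {σ} {τ} f≗g pf .runs x s =
  subst (λ y → RunsWithin (pf .code) (encode σ x) s (encode τ y) s _) (f≗g x) (pf .runs x s)
polyTime-≗ {τ = τ} f≗g pf .small x =
  subst (λ y → weightOf τ y ≤ _) (f≗g x) (pf .small x)

evaluate : (e : Expr 2) (space : Poly) {f : El σ → El τ} →
  (∀ x s → ⟦ e ⟧ (encode σ x ∷ s ∷ []) ≡ encode τ (f x)) →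
  (∀ x → weightOf τ (f x) ≤ eval space (weightOf σ x)) →
  PolyTime σ τ f
evaluate e p correct small .code  = X ≔ e
evaluate e p correct small .time  = ticks e
evaluate e p correct small .space = p
evaluate {σ} e p correct small .runs x s =
  subst (λ y → RunsWithin (X ≔ e) (encode σ x) s y s _) (correct x s) (runs-X e)
evaluate e p correct small .small = small

recode : {f : El σ → El τ} → (∀ x → encode τ (f x) ≡ encode σ x) → PolyTime σ τ f
recode eq = evaluate (var X) var (λ x s → ≡.sym (eq x)) (λ x → ≤-reflexive (≡.cong weight (eq x)))

identity : PolyTime σ σ (λ x → x)
identity = recode (λ _ → refl)

consᵖ : PolyTime (α ⊗ list α) (list α) (λ (x , xs) → x ∷ xs)
consᵖ = recode (λ _ → refl)

first : PolyTime (σ ⊗ τ) σ proj₁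
first = evaluate (hd (var X)) var (λ _ _ → refl) (λ _ → m≤n⇒m≤1+n (m≤m+n _ _))

second : PolyTime (σ ⊗ τ) τ proj₂
second {σ} = evaluate (tl (var X)) var (λ _ _ → refl) (λ (x , _) → m≤n⇒m≤1+n (m≤n+m _ (weightOf σ x)))

quoteTree : Tree → Expr 2
quoteTree nil     = nil
quoteTree (x ∙ y) = cons (quoteTree x) (quoteTree y)

⟦quoteTree⟧ : ∀ t σ → ⟦ quoteTree t ⟧ σ ≡ t
⟦quoteTree⟧ nil     σ = refl
⟦quoteTree⟧ (x ∙ y) σ = ≡.cong₂ _∙_ (⟦quoteTree⟧ x σ) (⟦quoteTree⟧ y σ)

constant : (y : El τ) → PolyTime σ τ (λ _ → y)
constant {τ} y = evaluate (quoteTree (encode τ y)) (con (weightOf τ y))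
  (λ _ _ → ⟦quoteTree⟧ (encode τ y) _) (λ _ → ≤-refl)

weight-head : ∀ t → weight (head t) ≤ weight t
weight-head nil     = z≤n
weight-head (x ∙ y) = m≤n⇒m≤1+n (m≤m+n _ _)

weight-tail : ∀ t → weight (tail t) ≤ weight t
weight-tail nil     = z≤n
weight-tail (x ∙ y) = m≤n⇒m≤1+n (m≤n+m _ (weight x))

polyTime-head : PolyTime tree tree head
polyTime-head = evaluate (hd (var X)) var (λ _ _ → refl) weight-head

polyTime-tail : PolyTime tree tree tail
polyTime-tail = evaluate (tl (var X)) var (λ _ _ → refl) weight-tail

infixr 9 _∘ᵖ_
-- The output bound `space` turns the running time of the second program, a function of the
-- intermediate value, into a function of the original input.
_∘ᵖ_ : {g : El τ → El υ} {f : El σ → El τ} →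
  PolyTime τ υ g → PolyTime σ τ f → PolyTime σ υ (λ x → g (f x))
(pg ∘ᵖ pf) .code  = pf .code ⨾ pg .code
(pg ∘ᵖ pf) .time  = pf .time ⨾ₚ (pg .time ∘ₚ pf .space)
(pg ∘ᵖ pf) .space = pg .space ∘ₚ pf .space
_∘ᵖ_ {f = f} pg pf .runs x s with pg .runs (f x) s
... | n , ⇓n , n≤ = pf .runs x s runs-⨾ (n , ⇓n , ≤-trans n≤ (eval-mono (pg .time) (pf .small x)))
_∘ᵖ_ {f = f} pg pf .small x = ≤-trans (pg .small (f x)) (eval-mono (pg .space) (pf .small x))

pushX swapXY popX : Command 2
pushX  = Y ≔ cons (var X) (var Y)
-- Pushing `X` first puts both values on the stack, from where each is moved to the other's place.
swapXY = Y ≔ cons (var X) (var Y)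
       ⨾ X ≔ hd (tl (var Y))
       ⨾ Y ≔ cons (hd (var Y)) (tl (tl (var Y)))
popX   = X ≔ hd (var Y) ⨾ Y ≔ tl (var Y)

-- The three assignments take `4`, `4` and `7` units, the two sequencings one each.
runs-swapXY : ∀ {x y s} → RunsWithin swapXY y (x ∙ s) x (y ∙ s) 17
runs-swapXY = runs-Y _ runs-⨾ runs-X _ runs-⨾ runs-Y _

runs-popX : ∀ {x y s} → RunsWithin popX y (x ∙ s) x s 7
runs-popX = runs-X _ runs-⨾ runs-Y _

infixr 4 _&_
-- The input waits on the stack while `f` is computed and is then exchanged with the result, so `g`
-- also starts from `x`.
_&_ : {f : El σ → El τ} {g : El σ → El υ} →
  PolyTime σ τ f → PolyTime σ υ g → PolyTime σ (τ ⊗ υ) (λ x → f x , g x)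
(pf & pg) .code =
  pushX ⨾ pf .code ⨾ swapXY ⨾ pg .code ⨾ X ≔ cons (hd (var Y)) (var X) ⨾ Y ≔ tl (var Y)
(pf & pg) .time =
  con 4 ⨾ₚ pf .time ⨾ₚ con 17 ⨾ₚ pg .time ⨾ₚ con 5 ⨾ₚ con 3
(pf & pg) .space = con 1 ⊕ (pf .space ⊕ pg .space)
(pf & pg) .runs x s =
  runs-Y (cons (var X) (var Y)) runs-⨾ pf .runs x _ runs-⨾ runs-swapXY runs-⨾ pg .runs x _ runs-⨾
  runs-X (cons (hd (var Y)) (var X)) runs-⨾ runs-Y (tl (var Y))
(pf & pg) .small x = s≤s (+-mono-≤ (pf .small x) (pg .small x))

-- The test only asks whether the encoding of `p x` is `nil`, so any type can be branched on. The
-- sum of the costs of both branches stands in for their maximum.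
branch : {p : El σ → El ρ} {f g : El σ → El τ} →
  PolyTime σ ρ p → PolyTime σ τ f → PolyTime σ τ g →
  PolyTime σ τ (λ x → when isCons (encode ρ (p x)) then f x else g x)
branch pp pf pg .code =
  pushX ⨾ pp .code ⨾ if var X then (popX ⨾ pf .code) else (popX ⨾ pg .code)
branch pp pf pg .time =
  con 4 ⨾ₚ pp .time ⨾ₚ con 2 ⊕ ((con 7 ⨾ₚ pf .time) ⊕ (con 7 ⨾ₚ pg .time))
branch pp pf pg .space = pf .space ⊕ pg .space
branch {σ} {ρ} {τ} {p} {f} {g} pp pf pg .runs x s =
  runs-Y _ runs-⨾ pp .runs x _ runs-⨾ conditional (encode ρ (p x))
  where
  n = weightOf σ x
  conditional : ∀ t → RunsWithin _ t (encode σ x ∙ s) (encode τ (when isCons t then f x else g x)) s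
    (2 + (eval (con 7 ⨾ₚ pf .time) n + eval (con 7 ⨾ₚ pg .time) n))
  conditional nil with runs-popX runs-⨾ pg .runs x s
  ... | m , ⇓m , m≤ = _ , if-false refl ⇓m , s≤s (s≤s (≤-trans m≤ (m≤n+m _ (eval (con 7 ⨾ₚ pf .time) n))))
  conditional (_ ∙ _) with runs-popX runs-⨾ pf .runs x s
  ... | m , ⇓m , m≤ = _ , if-true (λ ()) ⇓m , s≤s (s≤s (≤-trans m≤ (m≤m+n _ _)))
branch {σ} {ρ} {p = p} pp pf pg .small x with isCons (encode ρ (p x))
... | true  = ≤-trans (pf .small x) (m≤m+n _ _)
... | false = ≤-trans (pg .small x) (m≤n+m _ (eval (pf .space) (weightOf σ x)))

isCons-encodeBool : ∀ b → isCons (encodeBool b) ≡ b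
isCons-encodeBool true  = refl
isCons-encodeBool false = refl

ifᵖ : {p : El σ → Bool} {f g : El σ → El τ} →
  PolyTime σ bool p → PolyTime σ τ f → PolyTime σ τ g →
  PolyTime σ τ (λ x → when p x then f x else g x)
ifᵖ {p = p} {f} {g} pp pf pg =
  polyTime-≗ (λ x → ≡.cong (when_then f x else g x) (isCons-encodeBool (p x))) (branch pp pf pg)

-- Trace step b s n y: iterating step from s empties the worklist, the
-- first component of the state, after n rounds of at most b time units
-- each, and leaves y in the second component.
module _ {α β : Type} {step : El ((α ⊗ list α) ⊗ β) → El (list α ⊗ β)}
         (pstep : PolyTime ((α ⊗ list α) ⊗ β) (list α ⊗ β) step) where

  data Trace (b : ℕ) : El (list α ⊗ β) → ℕ → El β → Set where
    done : ∀ {y} → Trace b ([] , y) 0 y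
    more : ∀ {x xs y n z} →
      eval (pstep .time) (weightOf ((α ⊗ list α) ⊗ β) ((x , xs) , y)) ≤ b →
      Trace b (step ((x , xs) , y)) n z → Trace b (x ∷ xs , y) (suc n) z

  runs-loop : ∀ {b st n z} s → Trace b st n z →
    RunsWithin (while hd (var X) loop pstep .code) (encode (list α ⊗ β) st) s
               (nil ∙ encode β z) s (3 + n * (3 + b))
  runs-loop s done = _ , while-false refl , ≤-refl
  -- `x ∷ xs` and `(x , xs)` have the same encoding, so the body runs on the state as it stands. The
  -- loop test costs `3` units, once per round and once on exit.
  runs-loop {b} s (more {x} {xs} {y} {n} t≤b tr)
    with pstep .runs ((x , xs) , y) s | runs-loop s tr
  ... | m , ⇓m , m≤ | k , ⇓k , k≤ = _ , while-true (λ ()) ⇓m ⇓k , (begin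
    3 + m + k                       ≤⟨ +-mono-≤ (+-monoʳ-≤ 3 (≤-trans m≤ t≤b)) k≤ ⟩
    3 + b + (3 + n * (3 + b))       ≡⟨ +-comm (3 + b) _ ⟩
    3 + n * (3 + b) + (3 + b)       ≡⟨ +-assoc 3 (n * (3 + b)) _ ⟩
    3 + (n * (3 + b) + (3 + b))     ≡⟨ ≡.cong (3 +_) (+-comm (n * (3 + b)) _) ⟩
    3 + suc n * (3 + b)             ∎)
    where open ≤-Reasoning

  -- The budget `bound`, a polynomial in the weight of the input, has to cover every round; the
  -- sizes of all intermediate states must therefore be controlled where the `Trace` is built.
  worklist : {i : El σ → El (list α ⊗ β)} {g : El σ → El β} → PolyTime σ (list α ⊗ β) i →
    (rounds bound space : Poly) →
    (∀ x → let n = weightOf σ x in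
       ∃[ k ] Trace (eval bound n) (i x) k (g x) × k ≤ eval rounds n) →
    (∀ x → weightOf β (g x) ≤ eval space (weightOf σ x)) →
    PolyTime σ β g
  worklist pi r b p trace small .code =
    pi .code ⨾ (while hd (var X) loop pstep .code) ⨾ X ≔ tl (var X)
  worklist pi r b p trace small .time = pi .time ⨾ₚ (con 3 ⊕ r ⊛ (con 3 ⊕ b)) ⨾ₚ con 3
  worklist pi r b p trace small .space = p
  worklist {σ} pi r b p trace small .runs x s with trace x
  ... | k , tr , k≤ with runs-loop s tr
  ... | n , ⇓n , n≤ =
    pi .runs x s runs-⨾
    (n , ⇓n , ≤-trans n≤ (+-monoʳ-≤ 3 (*-monoˡ-≤ (3 + eval b (weightOf σ x)) k≤))) runs-⨾
    runs-X (tl (var X))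
  worklist pi r b p trace small .small = small

data Rounds {A B : Set} (step : (A × List A) × B → List A × B) : List A × B → ℕ → B → Set where
  done : ∀ {y} → Rounds step ([] , y) 0 y
  more : ∀ {x xs y n z} → Rounds step (step ((x , xs) , y)) n z → Rounds step (x ∷ xs , y) (suc n) z

-- When a round has constant cost, the sizes of the intermediate states are
-- irrelevant.
constant-time-worklist : {step : El ((α ⊗ list α) ⊗ β) → El (list α ⊗ β)} {i : El σ → El (list α ⊗ β)}
  {g : El σ → El β} (pstep : PolyTime ((α ⊗ list α) ⊗ β) (list α ⊗ β) step) →
  isConstant (pstep .time) ≡ true → PolyTime σ (list α ⊗ β) i → (rounds space : Poly) →
  (∀ x → ∃[ k ] Rounds step (i x) k (g x) × k ≤ eval rounds (weightOf σ x)) →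
  (∀ x → weightOf β (g x) ≤ eval space (weightOf σ x)) →
  PolyTime σ β g
constant-time-worklist {α} {β} {step = step} pstep steady pi r p rounds =
  worklist pstep pi r (con (eval (pstep .time) 0)) p
    (λ x → _ , trace (proj₁ (proj₂ (rounds x))) , proj₂ (proj₂ (rounds x)))
  where
  trace : ∀ {s n z} → Rounds step s n z → Trace pstep (eval (pstep .time) 0) s n z
  trace done     = done
  trace (more r) = more (≤-reflexive (eval-constant (pstep .time) steady _ 0)) (trace r)

length≤weight : ∀ τ (xs : List (El τ)) → length xs ≤ weightOf (list τ) xs
length≤weight τ []       = z≤n
length≤weight τ (x ∷ xs) = s≤s (≤-trans (length≤weight τ xs) (m≤n+m _ (weightOf τ x)))

-- Additive growth of the accumulator keeps its size polynomial after a
-- number of iterations that depends on the input.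
module _ {step : El ((α ⊗ ε) ⊗ β) → El β} (pstep : PolyTime ((α ⊗ ε) ⊗ β) β step)
         (growth : Poly)
         (grows : ∀ x e a → weightOf β (step ((x , e) , a)) ≤
                            weightOf β a + eval growth (weightOf (α ⊗ ε) (x , e))) where
  private
    body : PolyTime ((α ⊗ list α) ⊗ (ε ⊗ β)) (list α ⊗ (ε ⊗ β))
             (λ ((x , xs) , (e , a)) → xs , (e , step ((x , e) , a)))
    body = second ∘ᵖ first & first ∘ᵖ second &
           pstep ∘ᵖ ((first ∘ᵖ first & first ∘ᵖ second) & second ∘ᵖ second)

    result : El (list α ⊗ (ε ⊗ β)) → El β
    result (xs , (e , a)) = foldl (λ a x → step ((x , e) , a)) a xs

    tail≤ : ∀ x xs → weightOf (list α) xs ≤ weightOf (list α) (x ∷ xs)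
    tail≤ x xs = m≤n⇒m≤1+n (m≤n+m _ (weightOf α x))

    tail-fits : ∀ {x xs e h} → suc (weightOf (list α) (x ∷ xs) + weightOf ε e) ≤ h →
      suc (weightOf (list α) xs + weightOf ε e) ≤ h
    tail-fits {x} {xs} {e} = ≤-trans (s≤s (+-monoˡ-≤ (weightOf ε e) (tail≤ x xs)))

    -- A potential argument: each remaining element is charged `eval growth h` in advance. The bound
    -- `h` stays fixed because the list only shrinks.
    step-weight : ∀ {x xs e a h} → suc (weightOf (list α) (x ∷ xs) + weightOf ε e) ≤ h →
      weightOf β (step ((x , e) , a)) + length xs * eval growth h ≤
      weightOf β a + suc (length xs) * eval growth h
    step-weight {x} {xs} {e} {a} {h} fits = begin
      weightOf β (step ((x , e) , a)) + length xs * g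
        ≤⟨ +-monoˡ-≤ (length xs * g) (≤-trans (grows x e a) (+-monoʳ-≤ (weightOf β a) (eval-mono growth xe≤h))) ⟩
      weightOf β a + g + length xs * g
        ≡⟨ +-assoc (weightOf β a) g _ ⟩
      weightOf β a + suc (length xs) * g ∎
      where
      open ≤-Reasoning
      g = eval growth h
      xe≤h : weightOf (α ⊗ ε) (x , e) ≤ h
      xe≤h = ≤-trans (s≤s (+-monoˡ-≤ (weightOf ε e) (m≤n⇒m≤1+n (m≤m+n (weightOf α x) _)))) fits

  foldl-weight : ∀ xs {e a h} → suc (weightOf (list α) xs + weightOf ε e) ≤ h →
    weightOf β (result (xs , (e , a))) ≤ weightOf β a + length xs * eval growth h
  foldl-weight []       _    = m≤m+n _ 0
  foldl-weight (x ∷ xs) fits =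
    ≤-trans (foldl-weight xs (tail-fits {x} {xs} fits)) (step-weight {x} {xs} fits)

  private
    -- `w` bounds a potential of the whole state: remaining list, environment, accumulator and
    -- growth still to come. It never rises, so one time budget serves all rounds.
    trace : ∀ xs {e a h w} → suc (weightOf (list α) xs + weightOf ε e) ≤ h →
      suc (weightOf (list α) xs + suc (weightOf ε e + (weightOf β a + length xs * eval growth h))) ≤ w →
      Trace body (eval (body .time) w) (xs , (e , a)) (length xs) (e , result (xs , (e , a)))
    trace [] _ _ = done
    trace (x ∷ xs) {e} {a} fits ≤w =
      more (eval-mono (body .time) {weightOf (list α ⊗ (ε ⊗ β)) (x ∷ xs , (e , a))}
             (≤-trans (s≤s (+-monoʳ-≤ (weightOf (list α) (x ∷ xs))
               (s≤s (+-monoʳ-≤ (weightOf ε e) (m≤m+n (weightOf β a) _))))) ≤w))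
           (trace xs (tail-fits {x} {xs} fits)
             (≤-trans (s≤s (+-mono-≤ (tail≤ x xs) (s≤s (+-monoʳ-≤ (weightOf ε e) (step-weight {x} {xs} fits))))) ≤w))

  foldlᵖ : PolyTime (list α ⊗ (ε ⊗ β)) β (λ (xs , (e , a)) → foldl (λ a x → step ((x , e) , a)) a xs)
  -- The loop carries the environment next to the accumulator; the projection drops it at the end.
  foldlᵖ = second ∘ᵖ worklist body {g = λ st → proj₁ (proj₂ st) , result st} identity var
    (body .time ∘ₚ (var ⊕ total)) (con 1 ⊕ (var ⊕ total))
    traces
    (λ (xs , (e , a)) → s≤s (+-mono-≤
      (≤-trans (m≤m+n (weightOf ε e) (weightOf β a))
        (≤-trans (n≤1+n _) (≤-trans (m≤n+m _ (weightOf (list α) xs)) (n≤1+n _))))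
      (grown xs e a)))
    where
    open ≤-Reasoning
    total : Poly
    total = var ⊕ var ⊛ growth
    fits : ∀ xs e a → suc (weightOf (list α) xs + weightOf ε e) ≤ weightOf (list α ⊗ (ε ⊗ β)) (xs , (e , a))
    fits xs e a = s≤s (+-monoʳ-≤ (weightOf (list α) xs) (m≤n⇒m≤1+n (m≤m+n (weightOf ε e) _)))
    length≤ : ∀ xs e a → length xs ≤ weightOf (list α ⊗ (ε ⊗ β)) (xs , (e , a))
    length≤ xs e a = ≤-trans (length≤weight α xs) (m≤n⇒m≤1+n (m≤m+n _ _))
    a≤ : ∀ xs e a → weightOf β a ≤ weightOf (list α ⊗ (ε ⊗ β)) (xs , (e , a))
    a≤ xs e a = m≤n⇒m≤1+n (≤-trans (m≤n⇒m≤1+n (m≤n+m _ (weightOf ε e))) (m≤n+m _ (weightOf (list α) xs)))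
    grown : ∀ xs e a → weightOf β (result (xs , (e , a))) ≤ eval total (weightOf (list α ⊗ (ε ⊗ β)) (xs , (e , a)))
    grown xs e a = ≤-trans (foldl-weight xs (fits xs e a)) (+-mono-≤ (a≤ xs e a) (*-monoˡ-≤ _ (length≤ xs e a)))
    traces : ∀ st → let n = weightOf (list α ⊗ (ε ⊗ β)) st in
      ∃[ k ] Trace body (eval (body .time ∘ₚ (var ⊕ total)) n) st k (proj₁ (proj₂ st) , result st) × k ≤ n
    traces (xs , (e , a)) = length xs , trace xs (fits xs e a) below , length≤ xs e a
      where
      n = weightOf (list α ⊗ (ε ⊗ β)) (xs , (e , a))
      grown-by = length xs * eval growth n
      below : suc (weightOf (list α) xs + suc (weightOf ε e + (weightOf β a + grown-by))) ≤ n + eval total n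
      below = begin
        suc (weightOf (list α) xs + suc (weightOf ε e + (weightOf β a + grown-by)))
          ≡⟨ solve 4 (λ a b c d → con 1 :+ (a :+ (con 1 :+ (b :+ (c :+ d)))) :=
                                  (con 1 :+ (a :+ (con 1 :+ (b :+ c)))) :+ d)
               refl (weightOf (list α) xs) (weightOf ε e) (weightOf β a) grown-by ⟩
        n + grown-by
          ≤⟨ +-monoʳ-≤ n (≤-trans (*-monoˡ-≤ (eval growth n) (length≤ xs e a)) (m≤n+m _ n)) ⟩
        n + eval total n ∎
        where open +-*-Solver using (solve; _:+_; _:=_; con)

-- Case analysis, decisions and list operations

caseList : {A B C : Set} → (B → C) → ((A × List A) × B → C) → List A × B → C
caseList f g ([] , s)     = f s
caseList f g (y ∷ ys , s) = g ((y , ys) , s)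

-- A nonempty list already has the encoding of the pair that `g` expects; in the empty case the
-- leading `nil` is dropped before `f` runs.
caseListᵖ : {f : El σ → El τ} {g : El ((β ⊗ list β) ⊗ σ) → El τ} →
  PolyTime σ τ f → PolyTime ((β ⊗ list β) ⊗ σ) τ g → PolyTime (list β ⊗ σ) τ (caseList f g)
caseListᵖ pf pg .code  = if hd (var X) then pg .code else (X ≔ tl (var X) ⨾ pf .code)
caseListᵖ pf pg .time  = con 3 ⊕ (pg .time ⊕ (con 3 ⨾ₚ pf .time))
caseListᵖ pf pg .space = pf .space ⊕ pg .space
caseListᵖ {σ = σ} {β = β} pf pg .runs (y ∷ ys , s) st with pg .runs ((y , ys) , s) st
... | n , ⇓n , n≤ = _ , if-true (λ ()) ⇓n , s≤s (s≤s (s≤s (≤-trans n≤ (m≤m+n _ _))))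
caseListᵖ {σ = σ} {β = β} pf pg .runs ([] , s) st with runs-X (tl (var X)) runs-⨾ pf .runs s st
... | n , ⇓n , n≤ = _ , if-false refl ⇓n , s≤s (s≤s (s≤s (≤-trans n≤ (≤-trans
  (+-monoʳ-≤ 4 (eval-mono (pf .time) (n≤1+n _)))
  (m≤n+m _ (eval (pg .time) (suc (weightOf σ s))))))))
caseListᵖ {σ = σ} {β = β} pf pg .small ([] , s) =
  ≤-trans (pf .small s) (≤-trans (eval-mono (pf .space) (n≤1+n _)) (m≤m+n _ _))
caseListᵖ {σ = σ} {β = β} pf pg .small (y ∷ ys , s) =
  ≤-trans (pg .small ((y , ys) , s)) (m≤n+m _ (eval (pf .space) (weightOf (list β ⊗ σ) (y ∷ ys , s))))

-- Programs compute only the boolean of a decision. As `does` sends `_×-dec_` and `_⊎-dec_` to `_∧_`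
-- and `_∨_`, programs for such compound decisions are assembled without a separate correctness
-- argument.
Decides : (σ : Type) {P : El σ → Set} → (∀ x → Dec (P x)) → Set
Decides σ P? = PolyTime σ bool (λ x → does (P? x))

infixr 6 _∧ᵖ_
_∧ᵖ_ : {a b : El σ → Bool} → PolyTime σ bool a → PolyTime σ bool b → PolyTime σ bool (λ x → a x ∧ b x)
_∧ᵖ_ {a = a} pa pb = polyTime-≗ (λ x → lemma (a x)) (ifᵖ pa pb (constant false))
  where
  lemma : ∀ a {b} → (when a then b else false) ≡ a ∧ b
  lemma true  = refl
  lemma false = refl

infixr 5 _∨ᵖ_
_∨ᵖ_ : {a b : El σ → Bool} → PolyTime σ bool a → PolyTime σ bool b → PolyTime σ bool (λ x → a x ∨ b x)
_∨ᵖ_ {a = a} pa pb = polyTime-≗ (λ x → lemma (a x)) (ifᵖ pa (constant true) pb)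
  where
  lemma : ∀ a {b} → (when a then true else b) ≡ a ∨ b
  lemma true  = refl
  lemma false = refl

weight-encodeBool : ∀ b → weight (encodeBool b) ≤ 1
weight-encodeBool false = z≤n
weight-encodeBool true  = s≤s z≤n

weight-bool≤ : ∀ b {m} → weight (encodeBool b) ≤ m + 1
weight-bool≤ b {m} = ≤-trans (weight-encodeBool b) (m≤n+m 1 m)

anyᵖ : {P : El (α ⊗ ε) → Set} (P? : ∀ x → Dec (P x)) → Decides (α ⊗ ε) P? →
  Decides (list α ⊗ ε) (λ (xs , e) → any? (λ x → P? (x , e)) xs)
anyᵖ {α} {ε} P? pp = polyTime-≗
  (λ (xs , e) → ≡.trans (lemma e xs false) (∨-identityʳ (does (any? _ xs))))
  (foldlᵖ {ε = ε} (ifᵖ (pp ∘ᵖ first) (constant true) second) (con 1) (λ _ _ _ → weight-bool≤ _)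
    ∘ᵖ (first & second & constant false))
  where
  lemma : ∀ e xs b → foldl (λ b x → when does (P? (x , e)) then true else b) b xs
                     ≡ does (any? (λ x → P? (x , e)) xs) ∨ b
  lemma e []       b = refl
  lemma e (x ∷ xs) b with does (P? (x , e))
  ... | true  = ≡.trans (lemma e xs true) (∨-zeroʳ _)
  ... | false = lemma e xs b

allᵖ : {P : El (α ⊗ ε) → Set} (P? : ∀ x → Dec (P x)) → Decides (α ⊗ ε) P? →
  Decides (list α ⊗ ε) (λ (xs , e) → all? (λ x → P? (x , e)) xs)
allᵖ {α} {ε} P? pp = polyTime-≗
  (λ (xs , e) → ≡.trans (lemma e xs true) (∧-identityʳ (does (all? _ xs))))
  (foldlᵖ {ε = ε} (ifᵖ (pp ∘ᵖ first) second (constant false)) (con 1) (λ _ _ _ → weight-bool≤ _)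
    ∘ᵖ (first & second & constant true))
  where
  lemma : ∀ e xs b → foldl (λ b x → when does (P? (x , e)) then b else false) b xs
                     ≡ does (all? (λ x → P? (x , e)) xs) ∧ b
  lemma e []       b = refl
  lemma e (x ∷ xs) b with does (P? (x , e))
  ... | true  = lemma e xs b
  ... | false = ≡.trans (lemma e xs false) (∧-zeroʳ _)

-- Consing in a left fold reverses the order. The reversal is left in the specification instead of
-- being undone at run time.
filterᵖ : {P : El (α ⊗ ε) → Set} (P? : ∀ x → Dec (P x)) → Decides (α ⊗ ε) P? →
  PolyTime (list α ⊗ ε) (list α) (λ (xs , e) → filter (λ x → P? (x , e)) (reverse xs))
filterᵖ {α} {ε} P? pp = polyTime-≗
  (λ (xs , e) → ≡.trans (≡.sym (reverse-foldr (push e) [] xs)) (lemma e (reverse xs)))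
  (foldlᵖ {ε = ε} (ifᵖ (pp ∘ᵖ first) (consᵖ ∘ᵖ (first ∘ᵖ first & second)) second) var grows
    ∘ᵖ (first & second & constant []))
  where
  push : El ε → El α → List (El α) → List (El α)
  push e x ys = when does (P? (x , e)) then x ∷ ys else ys
  lemma : ∀ e xs → foldr (push e) [] xs ≡ filter (λ x → P? (x , e)) xs
  lemma e []       = refl
  lemma e (x ∷ xs) with does (P? (x , e))
  ... | true  = ≡.cong (x ∷_) (lemma e xs)
  ... | false = lemma e xs
  grows : ∀ x e ys → weightOf (list α) (push e x ys) ≤ weightOf (list α) ys + weightOf (α ⊗ ε) (x , e)
  grows x e ys with does (P? (x , e))
  ... | false = m≤m+n _ _
  ... | true  = ≤-trans (≤-reflexive (+-comm (suc (weightOf α x)) _))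
                        (+-monoʳ-≤ (weightOf (list α) ys) (s≤s (m≤m+n (weightOf α x) (weightOf ε e))))

pairWith : ∀ {A B : Set} → A → List (A × B) → List B → List (A × B)
pairWith x = foldl (λ acc y → (x , y) ∷ acc)

pairs : ∀ {A B : Set} → List A → List B → List (A × B)
pairs xs ys = foldl (λ acc x → pairWith x acc ys) [] xs

pairsᵖ : PolyTime (list α ⊗ list β) (list (α ⊗ β)) (λ (xs , ys) → pairs xs ys)
pairsᵖ {α} {β} =
  -- One row adds at most `length ys` pairs, each contributing at most `1` plus the weight of
  -- `(x , ys)`; hence the quadratic growth.
  foldlᵖ {ε = list β} row (var ⊛ (con 1 ⊕ var)) grows ∘ᵖ (first & second & constant [])
  where
  cell : PolyTime ((β ⊗ α) ⊗ list (α ⊗ β)) (list (α ⊗ β)) (λ ((y , x) , acc) → (x , y) ∷ acc)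
  cell = consᵖ ∘ᵖ ((second ∘ᵖ first & first ∘ᵖ first) & second)
  cell-grows : ∀ y x acc → weightOf (list (α ⊗ β)) ((x , y) ∷ acc) ≤
    weightOf (list (α ⊗ β)) acc + suc (weightOf (β ⊗ α) (y , x))
  cell-grows y x acc = ≤-reflexive (solve 3
    (λ x y a → con 1 :+ (con 1 :+ (x :+ y) :+ a) := a :+ (con 1 :+ (con 1 :+ (y :+ x)))) refl
    (weightOf α x) (weightOf β y) (weightOf (list (α ⊗ β)) acc))
    where open +-*-Solver using (solve; _:+_; _:=_; con)
  row : PolyTime ((α ⊗ list β) ⊗ list (α ⊗ β)) (list (α ⊗ β)) (λ ((x , ys) , acc) → pairWith x acc ys)
  row = foldlᵖ {ε = α} cell (con 1 ⊕ var) cell-grows ∘ᵖ (second ∘ᵖ first & first ∘ᵖ first & second)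
  grows : ∀ x ys acc → weightOf (list (α ⊗ β)) (pairWith x acc ys) ≤
    weightOf (list (α ⊗ β)) acc + eval (var ⊛ (con 1 ⊕ var)) (weightOf (α ⊗ list β) (x , ys))
  grows x ys acc = ≤-trans
    (foldl-weight {ε = α} cell (con 1 ⊕ var) cell-grows ys
      (≤-reflexive (≡.cong suc (+-comm (weightOf (list β) ys) _))))
    (+-monoʳ-≤ _ (*-monoˡ-≤ _ (≤-trans (length≤weight β ys) (m≤n⇒m≤1+n (m≤n+m _ (weightOf α x))))))

-- Equality tests and pointwise comparison

infix 4 _≟ᵗ_
_≟ᵗ_ : DecidableEquality Tree
nil     ≟ᵗ nil     = yes refl
nil     ≟ᵗ (_ ∙ _) = no (λ ())
(_ ∙ _) ≟ᵗ nil     = no (λ ())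
(a ∙ b) ≟ᵗ (c ∙ d) = map′ (λ { (refl , refl) → refl }) (λ { refl → refl , refl }) (a ≟ᵗ c ×-dec b ≟ᵗ d)

-- The machine cannot compare trees in one step, so pairs still to be compared are kept on a
-- worklist, which a mismatch empties. A round inspects only roots, hence has constant cost, and
-- `1 + 2 * weight a` counts the nodes of `a`, leaves included.
treeEqualᵖ : Decides (tree ⊗ tree) (λ (a , b) → a ≟ᵗ b)
treeEqualᵖ = constant-time-worklist {g = λ (a , b) → does (a ≟ᵗ b)} comparison refl
  ((consᵖ ∘ᵖ (identity & constant [])) & constant true) (con 1 ⊕ con 2 ⊛ var) (con 1)
  (λ (a , b) → _ , subst (Rounds compareHeads _ _) (∧-identityʳ _) (proj₁ (proj₂ (traced a b done))) ,
     ≤-trans (proj₂ (proj₂ (traced a b done)))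
       (≤-trans (≤-reflexive (+-identityʳ _)) (s≤s (*-monoʳ-≤ 2 (m≤n⇒m≤1+n (m≤m+n (weight a) (weight b)))))))
  (λ (a , b) → weight-encodeBool _)
  where
  compareHeads : El (((tree ⊗ tree) ⊗ list (tree ⊗ tree)) ⊗ bool) → El (list (tree ⊗ tree) ⊗ bool)
  compareHeads (((a , b) , ps) , r) =
    when isCons a then (when isCons b then ((head a , head b) ∷ (tail a , tail b) ∷ ps , r) else ([] , false))
                  else (when isCons b then ([] , false) else (ps , r))
  comparison : PolyTime (((tree ⊗ tree) ⊗ list (tree ⊗ tree)) ⊗ bool) (list (tree ⊗ tree) ⊗ bool) compareHeads
  comparison = branch left
    (branch right
      ((consᵖ ∘ᵖ ((polyTime-head ∘ᵖ left & polyTime-head ∘ᵖ right) &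
        consᵖ ∘ᵖ ((polyTime-tail ∘ᵖ left & polyTime-tail ∘ᵖ right) & second ∘ᵖ first))) & second)
      (constant ([] , false)))
    (branch right (constant ([] , false)) (second ∘ᵖ first & second))
    where
    left : PolyTime (((tree ⊗ tree) ⊗ list (tree ⊗ tree)) ⊗ bool) tree (λ (((a , b) , ps) , r) → a)
    left = first ∘ᵖ first ∘ᵖ first
    right : PolyTime (((tree ⊗ tree) ⊗ list (tree ⊗ tree)) ⊗ bool) tree (λ (((a , b) , ps) , r) → b)
    right = second ∘ᵖ first ∘ᵖ first
  traced : ∀ a b {ps r n z} → Rounds compareHeads (ps , r) n z →
    ∃[ k ] Rounds compareHeads ((a , b) ∷ ps , r) k (does (a ≟ᵗ b) ∧ z) × k ≤ suc (2 * weight a) + n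
  traced nil     nil     tr = _ , more tr , ≤-refl
  traced nil     (_ ∙ _) tr = _ , more done , s≤s z≤n
  traced (_ ∙ _) nil     tr = _ , more done , s≤s z≤n
  -- Runs are extended at the front, so the tails, which are compared after the heads, are treated
  -- first.
  traced (a₁ ∙ a₂) (b₁ ∙ b₂) {n = n} tr with traced a₂ b₂ tr
  ... | k₂ , tr₂ , k₂≤ with traced a₁ b₁ tr₂
  ... | k₁ , tr₁ , k₁≤ = _ , more (subst (Rounds compareHeads _ _) (≡.sym (∧-assoc (does (a₁ ≟ᵗ b₁)) _ _)) tr₁) ,
    (begin
      suc k₁ ≤⟨ s≤s k₁≤ ⟩
      suc (suc (2 * weight a₁) + k₂) ≤⟨ s≤s (+-monoʳ-≤ (suc (2 * weight a₁)) k₂≤) ⟩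
      suc (suc (2 * weight a₁) + (suc (2 * weight a₂) + n)) ≡⟨ solve 3 (λ a b n →
         con 1 :+ (con 1 :+ con 2 :* a :+ (con 1 :+ con 2 :* b :+ n)) :=
         con 1 :+ con 2 :* (con 1 :+ (a :+ b)) :+ n) refl (weight a₁) (weight a₂) n ⟩
      suc (2 * weight (a₁ ∙ a₂)) + n ∎)
    where
    open ≤-Reasoning
    open +-*-Solver using (solve; _:+_; _:*_; _:=_; con)

-- By injectivity, equality of encodings decides equality of elements, and any two decisions of one
-- proposition have the same boolean.
equalᵖ : (_≟_ : DecidableEquality (El τ)) → (∀ {x y} → encode τ x ≡ encode τ y → x ≡ y) →
  Decides (τ ⊗ τ) (λ (x , y) → x ≟ y)
equalᵖ {τ} _≟_ injective = polyTime-≗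
  (λ (x , y) → does-≡ (map′ injective (≡.cong (encode τ)) (encode τ x ≟ᵗ encode τ y)) (x ≟ y))
  (treeEqualᵖ ∘ᵖ recode (λ _ → refl))

memberᵖ : (_≟_ : DecidableEquality (El τ)) → Decides (τ ⊗ τ) (λ (x , y) → x ≟ y) →
  Decides (τ ⊗ list τ) (λ (x , ys) → any? (x ≟_) ys)
memberᵖ _≟_ p≟ = anyᵖ (λ (y , x) → x ≟ y) (p≟ ∘ᵖ (second & first)) ∘ᵖ (second & first)

-- The fold runs over `xs` and keeps the unread part of `ys` in its state. If `ys` is exhausted
-- early the verdict becomes false for good; if it is not exhausted at the end, `final` rejects.
pointwiseᵖ : {P : El ((α ⊗ β) ⊗ ε) → Set} (P? : ∀ x → Dec (P x)) → Decides ((α ⊗ β) ⊗ ε) P? →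
  Decides ((list α ⊗ list β) ⊗ ε) (λ ((xs , ys) , e) → decidable (λ x y → P? ((x , y) , e)) xs ys)
pointwiseᵖ {α} {β} {ε} P? pp = polyTime-≗
  (λ ((xs , ys) , e) → ≡.trans (lemma e xs ys true) (∧-identityʳ _))
  (caseListᵖ identity (constant false) ∘ᵖ
   foldlᵖ {α} {ε} {list β ⊗ bool} step (con 1) grows ∘ᵖ
   (first ∘ᵖ first & second & second ∘ᵖ first & constant true))
  where
  match : El ((β ⊗ list β) ⊗ ((α ⊗ ε) ⊗ bool)) → El (list β ⊗ bool)
  match ((y , ys) , ((x , e) , b)) = ys , (when does (P? ((x , y) , e)) then b else false)
  mismatch : El ((α ⊗ ε) ⊗ bool) → El (list β ⊗ bool)
  mismatch _ = [] , false
  next : El ((α ⊗ ε) ⊗ (list β ⊗ bool)) → El (list β ⊗ bool)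
  next (xe , (ys , b)) = caseList mismatch match (ys , (xe , b))
  step : PolyTime ((α ⊗ ε) ⊗ (list β ⊗ bool)) (list β ⊗ bool) next
  step = caseListᵖ (constant ([] , false))
      (second ∘ᵖ first & ifᵖ (pp ∘ᵖ ((first ∘ᵖ first ∘ᵖ second & first ∘ᵖ first) & second ∘ᵖ first ∘ᵖ second))
                             (second ∘ᵖ second) (constant false))
    ∘ᵖ (first ∘ᵖ second & first & second ∘ᵖ second)
  final : El (list β ⊗ bool) → Bool
  final = caseList (λ b → b) (λ _ → false)
  grows : ∀ x e s → weightOf (list β ⊗ bool) (next ((x , e) , s)) ≤ weightOf (list β ⊗ bool) s + 1
  grows x e ([] , b) = s≤s z≤n
  grows x e (y ∷ ys , b) = ≤-trans
    (s≤s (+-mono-≤ (m≤n⇒m≤1+n (m≤n+m (weightOf (list β) ys) (weightOf β y)))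
                   (weight-bool≤ (when does (P? ((x , y) , e)) then b else false) {weightOf bool b})))
    (s≤s (≤-reflexive (≡.sym (+-assoc (weightOf (list β) (y ∷ ys)) (weightOf bool b) 1))))
  lemma : ∀ e xs ys b → final (foldl (λ s x → next ((x , e) , s)) (ys , b) xs)
                        ≡ does (decidable (λ x y → P? ((x , y) , e)) xs ys) ∧ b
  lemma e []       []       b = refl
  lemma e []       (y ∷ ys) b = refl
  lemma e (x ∷ xs) []       b = ≡.trans (lemma e xs [] false) (∧-zeroʳ _)
  lemma e (x ∷ xs) (y ∷ ys) b with does (P? ((x , y) , e))
  ... | true  = lemma e xs ys b
  ... | false = ≡.trans (lemma e xs ys false) (∧-zeroʳ _)

-- Congruence closure and the finiteness test

-- The list `as` is fixed in advance, so the loop is unrolled into the program. Each element may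
-- have its own program, as symbols of different arities require.
allConstantsᵖ : ∀ {A : Set} {P : A → El σ → Set} (P? : ∀ a x → Dec (P a x)) → (∀ a → Decides σ (P? a)) →
  ∀ as → Decides σ (λ x → all? (λ a → P? a x) as)
allConstantsᵖ P? pp []       = constant true
allConstantsᵖ P? pp (a ∷ as) = pp a ∧ᵖ allConstantsᵖ P? pp as

weight-ʳ++ : ∀ τ xs ys → weightOf (list τ) (xs ʳ++ ys) ≡ weightOf (list τ) xs + weightOf (list τ) ys
weight-ʳ++ τ []       ys = refl
weight-ʳ++ τ (x ∷ xs) ys = ≡.trans (weight-ʳ++ τ xs (x ∷ ys))
  (solve 3 (λ a b c → a :+ (con 1 :+ (b :+ c)) := con 1 :+ (b :+ a) :+ c) refl
     (weightOf (list τ) xs) (weightOf τ x) (weightOf (list τ) ys))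
  where open +-*-Solver using (solve; _:+_; _:=_; con)

weight-filter : ∀ τ {P : El τ → Set} (P? : ∀ x → Dec (P x)) xs →
  weightOf (list τ) (filter P? xs) ≤ weightOf (list τ) xs
weight-filter τ P? []       = z≤n
weight-filter τ P? (x ∷ xs) with does (P? x)
... | true  = s≤s (+-monoʳ-≤ (weightOf τ x) (weight-filter τ P? xs))
... | false = m≤n⇒m≤1+n (≤-trans (weight-filter τ P? xs) (m≤n+m _ (weightOf τ x)))

weight-filter-reverse : ∀ τ {P : El τ → Set} (P? : ∀ x → Dec (P x)) xs →
  weightOf (list τ) (filter P? (reverse xs)) ≤ weightOf (list τ) xs
weight-filter-reverse τ P? xs = ≤-trans (weight-filter τ P? (reverse xs))
  (≤-reflexive (≡.trans (weight-ʳ++ τ xs []) (+-identityʳ _)))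

vectors : ∀ {A : Set} → List A → ∀ n → List (Vec A n)
vectors xs zero    = [] ∷ []
vectors xs (suc n) = map (uncurry _∷_) (pairs xs (vectors xs n))

encodeℕ-injective : ∀ {m n} → encodeℕ m ≡ encodeℕ n → m ≡ n
encodeℕ-injective {zero}  {zero}  eq = refl
encodeℕ-injective {suc m} {suc n} eq = ≡.cong suc (encodeℕ-injective (≡.cong tail eq))

weight-encodeℕ : ∀ n → weight (encodeℕ n) ≡ n
weight-encodeℕ zero    = refl
weight-encodeℕ (suc n) = ≡.cong suc (weight-encodeℕ n)

module _ {S : Signature} where
  open Signature S

  mutual
    encodeTerm-injective : ∀ {t u : Term S} → encodeTerm t ≡ encodeTerm u → t ≡ u
    encodeTerm-injective {node f ts} {node g us} eq
      with refl ← toℕ-injective {i = f} {j = g} (encodeℕ-injective (≡.cong head eq)) =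
      ≡.cong (node f) (encodeTerms-injective (≡.cong tail eq))

    encodeTerms-injective : ∀ {n} {ts us : Vec (Term S) n} → encodeTerms ts ≡ encodeTerms us → ts ≡ us
    encodeTerms-injective {ts = []}     {[]}     eq = refl
    encodeTerms-injective {ts = t ∷ ts} {u ∷ us} eq =
      ≡.cong₂ _∷_ (encodeTerm-injective (≡.cong head eq)) (encodeTerms-injective (≡.cong tail eq))

  infix 4 _≟_ _≟²_
  _≟_ : DecidableEquality (Term S)
  t ≟ u = map′ encodeTerm-injective (≡.cong encodeTerm) (encodeTerm t ≟ᵗ encodeTerm u)

  _≟²_ : DecidableEquality (Equation S)
  _≟²_ = ≡-dec _≟_ _≟_

  -- Arguments form a list rather than a vector of length `arity f`, so that applications of
  -- different symbols are compared without transport.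
  Application : Set
  Application = Fin symbols × List (Term S)

  view : Term S → Application
  view (node f ts) = f , toList ts

  infix 4 _∈?_
  _∈?_ : (e : Equation S) (R : List (Equation S)) → Dec (e ∈ R)
  e ∈? R = any? (e ≟²_) R

  Matches : List (Equation S) → Application → Term S → Set
  Matches R (f , ts) v = f ≡ proj₁ (view v) × Pointwise (λ t u → (t , u) ∈ R) ts (proj₂ (view v))

  matches? : ∀ R a v → Dec (Matches R a v)
  matches? R (f , ts) v =
    f Fin.≟ proj₁ (view v) ×-dec decidable (λ t u → (t , u) ∈? R) ts (proj₂ (view v))

  -- Euclidean closure and reflexivity together give symmetry and transitivity.
  Derivable : List (Equation S) → List (Equation S) → Equation S → Set
  Derivable Γ R (s , t) =
    (s , t) ∈ R ⊎ s ≡ t ⊎ (s , t) ∈ Γ ⊎ Matches R (view s) t ⊎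
    Any (λ e → proj₂ e ≡ s × (proj₁ e , t) ∈ R) R

  derivable? : ∀ Γ R e → Dec (Derivable Γ R e)
  derivable? Γ R (s , t) =
    (s , t) ∈? R ⊎-dec s ≟ t ⊎-dec (s , t) ∈? Γ ⊎-dec matches? R (view s) t ⊎-dec
    any? (λ e → proj₂ e ≟ s ×-dec (proj₁ e , t) ∈? R) R

  -- Each round filters the whole of `U` anew instead of extending `R`. Hence no stage outweighs
  -- `U`, and stages can be compared by their lengths.
  derive : List (Equation S) → List (Equation S) → List (Equation S) → List (Equation S)
  derive Γ U R = filter (derivable? Γ R) (reverse U)

  -- `U` doubles as the round counter: a growing list of pairs from `U` can lengthen at most
  -- `length U` times.
  saturate : List (Equation S) → List (Equation S) → List (Equation S)
  saturate Γ U = foldl (λ R _ → derive Γ U R) [] U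

  -- Applications without arguments: vectors over [] exist only in length 0.
  constants : List (Term S)
  constants = concatMap (λ f → map (node f) (vectors [] (arity f))) (allFin symbols)

  collect : ∀ {n} → Vec (Term S) n → List (Term S) → List (Term S)
  collect []               acc = acc
  collect (node f us ∷ ts) acc = collect ts (collect us (node f us ∷ acc))

  subterms : List (Equation S) → List (Term S)
  subterms = foldl (λ acc e → collect (proj₁ e ∷ proj₂ e ∷ []) acc) constants

  congruence : List (Equation S) → List (Equation S)
  congruence Γ = saturate Γ (pairs (subterms Γ) (subterms Γ))

  -- Equality with a member of `T` is expressed by `Matches`, a single congruence step over `R`, so
  -- that it is decided by searching finite lists.
  Total : List (Equation S) → List (Term S) → Set
  Total R T = All (λ f → All (λ ts → Any (Matches R (f , toList ts)) T) (vectors T (arity f))) (allFin symbols)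

  total? : ∀ R T → Dec (Total R T)
  total? R T = all? (λ f → all? (λ ts → any? (matches? R (f , toList ts)) T) (vectors T (arity f))) (allFin symbols)

  -- Running time of the closure and of the finiteness test

  term symbol equation : Type
  term     = base (encodeTerm {S})
  symbol   = base (λ f → encodeℕ (toℕ {symbols} f))
  equation = term ⊗ term

  vec : ℕ → Type
  vec n = base (encodeTerms {S} {n})

  encode-toList : ∀ {n} (ts : Vec (Term S) n) → encode (list term) (toList ts) ≡ encodeTerms ts
  encode-toList []       = refl
  encode-toList (t ∷ ts) = ≡.cong (encodeTerm t ∙_) (encode-toList ts)

  toListᵖ : ∀ {n} → PolyTime (vec n) (list term) toList
  toListᵖ = recode encode-toList

  viewᵖ : PolyTime term (symbol ⊗ list term) view
  viewᵖ = recode λ { (node f ts) → ≡.cong (encodeℕ (toℕ f) ∙_) (encode-toList ts) }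

  symbolEqualᵖ : Decides (symbol ⊗ symbol) (λ (f , g) → f Fin.≟ g)
  symbolEqualᵖ = equalᵖ Fin._≟_ (λ eq → toℕ-injective (encodeℕ-injective eq))

  termEqualᵖ : Decides (term ⊗ term) (λ (t , u) → t ≟ u)
  termEqualᵖ = equalᵖ _≟_ encodeTerm-injective

  equationEqualᵖ : Decides (equation ⊗ equation) (λ (e , e′) → e ≟² e′)
  equationEqualᵖ = equalᵖ _≟²_ λ eq →
    ≡.cong₂ _,_ (encodeTerm-injective (≡.cong head eq)) (encodeTerm-injective (≡.cong tail eq))

  ∈ᵖ : Decides (equation ⊗ list equation) (λ (e , R) → e ∈? R)
  ∈ᵖ = memberᵖ _≟²_ equationEqualᵖ

  matchesᵖ : Decides (((symbol ⊗ list term) ⊗ term) ⊗ list equation) (λ ((a , v) , R) → matches? R a v)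
  matchesᵖ =
    symbolEqualᵖ ∘ᵖ (first ∘ᵖ application & first ∘ᵖ candidate) ∧ᵖ
    pointwiseᵖ (λ (e , R) → e ∈? R) ∈ᵖ ∘ᵖ ((second ∘ᵖ application & second ∘ᵖ candidate) & second)
    where
    application : PolyTime (((symbol ⊗ list term) ⊗ term) ⊗ list equation) (symbol ⊗ list term) (λ ((a , v) , R) → a)
    application = first ∘ᵖ first
    candidate : PolyTime (((symbol ⊗ list term) ⊗ term) ⊗ list equation) (symbol ⊗ list term) (λ ((a , v) , R) → view v)
    candidate = viewᵖ ∘ᵖ second ∘ᵖ first

  derivableᵖ : Decides (equation ⊗ (list equation ⊗ list equation)) (λ (e , (R , Γ)) → derivable? Γ R e)
  derivableᵖ =
    ∈ᵖ ∘ᵖ (first & relation) ∨ᵖ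
    termEqualᵖ ∘ᵖ first ∨ᵖ
    ∈ᵖ ∘ᵖ (first & second ∘ᵖ second) ∨ᵖ
    matchesᵖ ∘ᵖ ((viewᵖ ∘ᵖ first ∘ᵖ first & second ∘ᵖ first) & relation) ∨ᵖ
    anyᵖ {ε = equation ⊗ list equation} (λ (e , ((s , t) , R)) → proj₂ e ≟ s ×-dec (proj₁ e , t) ∈? R)
      (termEqualᵖ ∘ᵖ (second ∘ᵖ first & first ∘ᵖ first ∘ᵖ second) ∧ᵖ
       ∈ᵖ ∘ᵖ ((first ∘ᵖ first & second ∘ᵖ first ∘ᵖ second) & second ∘ᵖ second))
      ∘ᵖ (relation & (first & relation))
    where
    relation : PolyTime (equation ⊗ (list equation ⊗ list equation)) (list equation) (λ (e , (R , Γ)) → R)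
    relation = first ∘ᵖ second

  deriveᵖ : PolyTime ((list equation ⊗ list equation) ⊗ list equation) (list equation)
    (λ ((Γ , U) , R) → derive Γ U R)
  deriveᵖ = filterᵖ (λ (e , (R , Γ)) → derivable? Γ R e) derivableᵖ ∘ᵖ
    (second ∘ᵖ first & (second & first ∘ᵖ first))

  -- A bound obtained by iterating the polynomial of `deriveᵖ` would explode. But a derived list
  -- never outweighs `U`, which belongs to the environment, so growth is additive.
  saturateᵖ : PolyTime (list equation ⊗ list equation) (list equation) (λ (Γ , U) → saturate Γ U)
  saturateᵖ =
    foldlᵖ {equation} {list equation ⊗ list equation} {list equation}
      (deriveᵖ ∘ᵖ (second ∘ᵖ first & second)) var grows ∘ᵖ (second & identity & constant [])
    where
    grows : ∀ e ΓU R → weightOf (list equation) (derive (proj₁ ΓU) (proj₂ ΓU) R) ≤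
      weightOf (list equation) R + weightOf (equation ⊗ (list equation ⊗ list equation)) (e , ΓU)
    grows e (Γ , U) R = ≤-trans (weight-filter-reverse equation (derivable? Γ R) U)
      (≤-trans (≤-trans (m≤n⇒m≤1+n (m≤n+m _ (weightOf (list equation) Γ)))
                 (m≤n⇒m≤1+n (m≤n+m _ (weightOf equation e))))
        (m≤n+m _ (weightOf (list equation) R)))

  -- Every visited subterm adds an entry of weight at most `b` and one list cell, and there are at
  -- most `weightOf (vec n) ts` of them.
  weight-collect : ∀ {n} (ts : Vec (Term S) n) {acc b} → weightOf (vec n) ts ≤ b →
    weightOf (list term) (collect ts acc) ≤ weightOf (list term) acc + weightOf (vec n) ts * suc b
  weight-collect [] _ = m≤m+n _ 0
  weight-collect {suc n} (t@(node f us) ∷ ts) {acc} {b} ≤b = begin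
    weightOf (list term) (collect ts (collect us (t ∷ acc)))
      ≤⟨ weight-collect ts (≤-trans (m≤n⇒m≤1+n (m≤n+m _ (weight (encodeTerm t)))) ≤b) ⟩
    weightOf (list term) (collect us (t ∷ acc)) + w ts * suc b
      ≤⟨ +-monoˡ-≤ _ (weight-collect us (≤-trans us≤ (≤-trans t≤ ≤b))) ⟩
    suc (weight (encodeTerm t) + weightOf (list term) acc) + w us * suc b + w ts * suc b
      ≤⟨ +-monoˡ-≤ (w ts * suc b) (+-monoˡ-≤ (w us * suc b)
           (s≤s (+-monoˡ-≤ (weightOf (list term) acc) (≤-trans t≤ ≤b)))) ⟩
    suc (b + weightOf (list term) acc) + w us * suc b + w ts * suc b
      ≡⟨ solve 4 (λ b a u t → con 1 :+ (b :+ a) :+ u :* (con 1 :+ b) :+ t :* (con 1 :+ b) :=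
                              a :+ (con 1 :+ u :+ t) :* (con 1 :+ b)) refl b (weightOf (list term) acc) (w us) (w ts) ⟩
    weightOf (list term) acc + suc (w us + w ts) * suc b
      ≤⟨ +-monoʳ-≤ (weightOf (list term) acc) (*-monoˡ-≤ (suc b) (s≤s (+-monoˡ-≤ (w ts) us≤))) ⟩
    weightOf (list term) acc + w (t ∷ ts) * suc b ∎
    where
    open ≤-Reasoning
    open +-*-Solver using (solve; _:+_; _:*_; _:=_; con)
    w : ∀ {n} → Vec (Term S) n → ℕ
    w ts = weight (encodeTerms ts)
    t≤ : weight (encodeTerm t) ≤ w (t ∷ ts)
    t≤ = m≤n⇒m≤1+n (m≤m+n _ _)
    us≤ : w us ≤ weight (encodeTerm t)
    us≤ = m≤n⇒m≤1+n (m≤n+m _ (weight (encodeℕ (toℕ f))))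

  weight-pair : ∀ (p q : Term S) → weightOf (vec 2) (p ∷ q ∷ []) ≡ suc (weightOf equation (p , q))
  weight-pair p q = ≡.cong suc (≡.trans (+-suc (weight (encodeTerm p)) _)
    (≡.cong (λ n → suc (weight (encodeTerm p) + n)) (+-identityʳ _)))

  -- The recursion of `collect` is run with an explicit stack of argument lists still to be visited.
  -- A visit takes constant time because the encoding of a term already contains its arguments as a
  -- list.
  collectᵖ : PolyTime (equation ⊗ list term) (list term) (λ ((p , q) , acc) → collect (p ∷ q ∷ []) acc)
  collectᵖ = constant-time-worklist visitᵖ refl
    (consᵖ ∘ᵖ (consᵖ ∘ᵖ (first ∘ᵖ first & consᵖ ∘ᵖ (second ∘ᵖ first & constant [])) & constant [])
      & second)
    (con 1 ⊕ con 2 ⊛ var) (var ⊕ var ⊛ (con 1 ⊕ var))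
    (λ ((p , q) , acc) → _ , visits (p ∷ q ∷ []) done , (begin
      count (p ∷ q ∷ []) + 0               ≡⟨ +-identityʳ _ ⟩
      count (p ∷ q ∷ [])                   ≤⟨ count≤ (p ∷ q ∷ []) ⟩
      suc (2 * weightOf (vec 2) (p ∷ q ∷ [])) ≤⟨ s≤s (*-monoʳ-≤ 2 (pair≤ p q acc)) ⟩
      suc (2 * weightOf (equation ⊗ list term) ((p , q) , acc)) ∎))
    (λ ((p , q) , acc) → ≤-trans (weight-collect (p ∷ q ∷ []) {acc} ≤-refl)
      (+-mono-≤ (m≤n⇒m≤1+n (m≤n+m _ (weightOf equation (p , q))))
                (*-mono-≤ (pair≤ p q acc) (s≤s (pair≤ p q acc)))))
    where
    open ≤-Reasoning
    pair≤ : ∀ p q acc → weightOf (vec 2) (p ∷ q ∷ []) ≤ weightOf (equation ⊗ list term) ((p , q) , acc)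
    pair≤ p q acc = ≤-trans (≤-reflexive (weight-pair p q)) (s≤s (m≤m+n _ _))
    visit : (List (Term S) × List (List (Term S))) × List (Term S) → List (List (Term S)) × List (Term S)
    visit ((ts , stack) , acc) = caseList (λ s → s)
      (λ ((t , ts) , (stack , acc)) → proj₂ (view t) ∷ ts ∷ stack , t ∷ acc) (ts , (stack , acc))
    visitᵖ : PolyTime ((list term ⊗ list (list term)) ⊗ list term) (list (list term) ⊗ list term) visit
    visitᵖ = caseListᵖ identity
        (consᵖ ∘ᵖ (second ∘ᵖ viewᵖ ∘ᵖ first ∘ᵖ first & consᵖ ∘ᵖ (second ∘ᵖ first & first ∘ᵖ second))
          & consᵖ ∘ᵖ (first ∘ᵖ first & second ∘ᵖ second))
      ∘ᵖ (first ∘ᵖ first & second ∘ᵖ first & second)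
    -- One round for each term and one for each exhausted argument list.
    count : ∀ {n} → Vec (Term S) n → ℕ
    count []               = 1
    count (node f us ∷ ts) = suc (count us + count ts)
    visits : ∀ {n} (ts : Vec (Term S) n) {stack acc k z} →
      Rounds visit (stack , collect ts acc) k z → Rounds visit (toList ts ∷ stack , acc) (count ts + k) z
    visits []               r = more r
    visits (node f us ∷ ts) {stack} {acc} {k} {z} r = more
      (subst (λ k → Rounds visit (toList us ∷ toList ts ∷ stack , node f us ∷ acc) k z)
      (≡.sym (+-assoc (count us) (count ts) k)) (visits us (visits ts r)))
    count≤ : ∀ {n} (ts : Vec (Term S) n) → count ts ≤ suc (2 * weightOf (vec n) ts)
    count≤ [] = ≤-refl
    count≤ (node f us ∷ ts) = begin
      suc (count us + count ts)
        ≤⟨ s≤s (+-mono-≤ (count≤ us) (count≤ ts)) ⟩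
      suc (suc (2 * u) + suc (2 * t))
        ≡⟨ solve 2 (λ u t → con 1 :+ (con 1 :+ con 2 :* u :+ (con 1 :+ con 2 :* t)) :=
                            con 1 :+ con 2 :* (con 1 :+ (u :+ t))) refl u t ⟩
      suc (2 * suc (u + t))
        ≤⟨ s≤s (*-monoʳ-≤ 2 (s≤s (+-monoˡ-≤ t (m≤n⇒m≤1+n (m≤n+m u (weight (encodeℕ (toℕ f)))))))) ⟩
      suc (2 * weightOf (vec _) (node f us ∷ ts)) ∎
      where
      open +-*-Solver using (solve; _:+_; _:*_; _:=_; con)
      u = weightOf (vec _) us
      t = weightOf (vec _) ts

  subtermsᵖ : PolyTime (list equation) (list term) subterms
  -- `foldlᵖ` expects an environment; the tree `nil` is a dummy one.
  subtermsᵖ = foldlᵖ {equation} {tree} {list term} (collectᵖ ∘ᵖ (first ∘ᵖ first & second))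
    (var ⊛ (con 1 ⊕ var)) grows ∘ᵖ (identity & constant nil & constant constants)
    where
    grows : ∀ e t acc → weightOf (list term) (collect (proj₁ e ∷ proj₂ e ∷ []) acc) ≤
      weightOf (list term) acc + eval (var ⊛ (con 1 ⊕ var)) (weightOf (equation ⊗ tree) (e , t))
    grows (p , q) t acc = ≤-trans (weight-collect (p ∷ q ∷ []) {acc} ≤-refl)
      (+-monoʳ-≤ (weightOf (list term) acc) (*-mono-≤ pair≤ (s≤s pair≤)))
      where
      pair≤ : weightOf (vec 2) (p ∷ q ∷ []) ≤ weightOf (equation ⊗ tree) ((p , q) , t)
      pair≤ = ≤-trans (≤-reflexive (weight-pair p q)) (s≤s (m≤m+n _ _))

  congruenceᵖ : PolyTime (list equation) (list equation) congruence
  congruenceᵖ = saturateᵖ ∘ᵖ (identity & pairsᵖ ∘ᵖ (subtermsᵖ & subtermsᵖ))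

  -- The length `n` is fixed, so the recursion takes place in the construction of the program, and
  -- only the degree of its bound depends on `n`.
  vectorsᵖ : ∀ n → PolyTime (list term) (list (vec n)) (λ T → vectors T n)
  vectorsᵖ zero    = constant ([] ∷ [])
  vectorsᵖ (suc n) = recode {f = map (uncurry _∷_)} encode-map ∘ᵖ pairsᵖ ∘ᵖ (identity & vectorsᵖ n)
    where
    encode-map : ∀ ps → encode (list (vec (suc n))) (map (uncurry _∷_) ps) ≡ encode (list (term ⊗ vec n)) ps
    encode-map []       = refl
    encode-map (p ∷ ps) = ≡.cong (encode (term ⊗ vec n) p ∙_) (encode-map ps)

  totalᵖ : Decides (list equation ⊗ list term) (λ (R , T) → total? R T)
  totalᵖ = allConstantsᵖ
    (λ f (R , T) → all? (λ ts → any? (matches? R (f , toList ts)) T) (vectors T (arity f)))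
    (λ f → allᵖ {vec (arity f)} {list equation ⊗ list term} (λ (ts , (R , T)) → any? (matches? R (f , toList ts)) T)
        (anyᵖ {ε = vec (arity f) ⊗ list equation} (λ (v , (ts , R)) → matches? R (f , toList ts) v)
          (matchesᵖ ∘ᵖ (((constant f & toListᵖ ∘ᵖ first ∘ᵖ second) & first) & second ∘ᵖ second))
        ∘ᵖ (second ∘ᵖ second & (first & first ∘ᵖ second)))
      ∘ᵖ (vectorsᵖ (arity f) ∘ᵖ second & identity))
    (allFin symbols)

  finiteᵖ : Decides (list equation) (λ Γ → total? (congruence Γ) (subterms Γ))
  finiteᵖ = totalᵖ ∘ᵖ (congruenceᵖ & subtermsᵖ)

-- Correctness of congruence closure

pairWith-acc : ∀ {x : A} {e : A × B} ys {acc} → e ∈ acc → e ∈ pairWith x acc ys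
pairWith-acc []       e∈ = e∈
pairWith-acc (y ∷ ys) e∈ = pairWith-acc ys (there e∈)

∈-pairWith⁺ : ∀ {x : A} {y : B} {ys acc} → y ∈ ys → (x , y) ∈ pairWith x acc ys
∈-pairWith⁺ {ys = y ∷ ys} (here refl) = pairWith-acc ys (here refl)
∈-pairWith⁺ (there y∈)                = ∈-pairWith⁺ y∈

∈-pairWith⁻ : ∀ {x a : A} {b : B} ys {acc} → (a , b) ∈ pairWith x acc ys → (a , b) ∈ acc ⊎ (a ≡ x × b ∈ ys)
∈-pairWith⁻ []       e∈ = inj₁ e∈
∈-pairWith⁻ (y ∷ ys) e∈ with ∈-pairWith⁻ ys e∈
... | inj₁ (here refl)  = inj₂ (refl , here refl)
... | inj₁ (there e∈)   = inj₁ e∈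
... | inj₂ (eq , b∈)    = inj₂ (eq , there b∈)

∈-pairs⁺ : ∀ {x : A} {y : B} {xs ys} → x ∈ xs → y ∈ ys → (x , y) ∈ pairs xs ys
∈-pairs⁺ {ys = ys} = go
  where
  keep : ∀ {e} xs {acc} → e ∈ acc → e ∈ foldl (λ acc x → pairWith x acc ys) acc xs
  keep []       e∈ = e∈
  keep (x ∷ xs) e∈ = keep xs (pairWith-acc ys e∈)
  go : ∀ {x y xs acc} → x ∈ xs → y ∈ ys → (x , y) ∈ foldl (λ acc x → pairWith x acc ys) acc xs
  go {xs = x ∷ xs} (here refl) y∈ = keep xs (∈-pairWith⁺ y∈)
  go (there x∈) y∈ = go x∈ y∈

∈-pairs⁻ : ∀ {x : A} {y : B} xs ys → (x , y) ∈ pairs xs ys → x ∈ xs × y ∈ ys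
∈-pairs⁻ {x = x} {y} xs ys e∈ = Sum.[ (λ ()) , id ] (go xs e∈)
  where
  go : ∀ xs {acc} → (x , y) ∈ foldl (λ acc x → pairWith x acc ys) acc xs → (x , y) ∈ acc ⊎ (x ∈ xs × y ∈ ys)
  go []        e∈ = inj₁ e∈
  go (x′ ∷ xs) e∈ with go xs e∈
  ... | inj₂ (x∈ , y∈) = inj₂ (there x∈ , y∈)
  ... | inj₁ e∈′ with ∈-pairWith⁻ ys e∈′
  ...   | inj₁ e∈acc      = inj₁ e∈acc
  ...   | inj₂ (eq , y∈)  = inj₂ (here eq , y∈)

∈-vectors⁺ : ∀ {xs : List A} {n} {v : Vec A n} → VecAll.All (_∈ xs) v → v ∈ vectors xs n
∈-vectors⁺ []        = here refl
∈-vectors⁺ (x∈ ∷ v∈) = ∈-map⁺ (uncurry _∷_) (∈-pairs⁺ x∈ (∈-vectors⁺ v∈))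

∈-vectors⁻ : ∀ (xs : List A) {n} {v : Vec A n} → v ∈ vectors xs n → VecAll.All (_∈ xs) v
∈-vectors⁻ xs {zero}  {[]} _ = []
∈-vectors⁻ xs {suc n} v∈ with ∈-map⁻ (uncurry _∷_) v∈
... | (x , v) , p∈ , refl with ∈-pairs⁻ xs (vectors xs n) p∈
... | x∈ , v∈′ = x∈ ∷ ∈-vectors⁻ xs v∈′

-- A position accepted by `Q` alone would make the second list strictly longer. A fixed point is
-- thus recognized by length.
filter-saturated : ∀ {P Q : A → Set} (P? : ∀ x → Dec (P x)) (Q? : ∀ x → Dec (Q x)) xs →
  (∀ {x} → x ∈ xs → P x → Q x) → length (filter Q? xs) ≤ length (filter P? xs) →
  filter P? xs ≡ filter Q? xs
filter-saturated P? Q? [] _ _ = refl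
filter-saturated P? Q? (x ∷ xs) P⊆Q le with P? x | Q? x
... | yes px | yes qx = ≡.cong (x ∷_) (filter-saturated P? Q? xs (P⊆Q ∘ there) (≤-pred le))
... | yes px | no ¬qx = contradiction (P⊆Q (here refl) px) ¬qx
... | no ¬px | no ¬qx = filter-saturated P? Q? xs (P⊆Q ∘ there) le
... | no ¬px | yes qx = contradiction
  (≤-trans le (mono xs (P⊆Q ∘ there))) (<-irrefl refl)
  where
  mono : ∀ xs → (∀ {x} → x ∈ xs → _ → _) → length (filter P? xs) ≤ length (filter Q? xs)
  mono [] _ = z≤n
  mono (y ∷ ys) h with P? y | Q? y
  ... | yes _  | yes _  = s≤s (mono ys (h ∘ there))
  ... | yes py | no ¬qy = contradiction (h (here refl) py) ¬qy
  ... | no _   | yes _  = m≤n⇒m≤1+n (mono ys (h ∘ there))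
  ... | no _   | no _   = mono ys (h ∘ there)

lookup-injective : ∀ {xs : List A} → Unique xs → ∀ i j → List.lookup xs i ≡ List.lookup xs j → i ≡ j
lookup-injective {xs = _ ∷ _}  _         zero    zero    _  = refl
lookup-injective {xs = _ ∷ xs} (x∉ ∷ _)  zero    (suc j) eq = contradiction eq (All.lookup x∉ (∈-lookup j))
lookup-injective {xs = _ ∷ xs} (x∉ ∷ _)  (suc i) zero    eq = contradiction (≡.sym eq) (All.lookup x∉ (∈-lookup i))
lookup-injective {xs = _ ∷ _}  (_ ∷ uq)  (suc i) (suc j) eq = ≡.cong suc (lookup-injective uq i j eq)

firstOr : {P : A → Set} → A → (∀ x → Dec (P x)) → List A → A
firstOr d P? []       = d
firstOr d P? (x ∷ xs) = when does (P? x) then x else firstOr d P? xs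

module _ {P : A → Set} (P? : ∀ x → Dec (P x)) where

  firstOr-default : ∀ {d} xs → ¬ Any P xs → firstOr d P? xs ≡ d
  firstOr-default []       ¬any = refl
  firstOr-default (x ∷ xs) ¬any with P? x
  ... | yes px = contradiction (here px) ¬any
  ... | no  _  = firstOr-default xs (¬any ∘ there)

  firstOr-satisfies : ∀ {d} xs → Any P xs → P (firstOr d P? xs) × firstOr d P? xs ∈ xs
  firstOr-satisfies (x ∷ xs) any with P? x | any
  ... | yes px | _          = px , here refl
  ... | no ¬px | here px    = contradiction px ¬px
  ... | no ¬px | there any′ with firstOr-satisfies xs any′
  ...   | p , ∈xs = p , there ∈xs

-- The first hit depends only on which elements are accepted, and the default is never reached. This
-- makes representatives of congruent terms literally equal.
firstOr-cong : ∀ {P Q : A → Set} (P? : ∀ x → Dec (P x)) (Q? : ∀ x → Dec (Q x)) {d e} xs →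
  (∀ {x} → P x → Q x) → (∀ {x} → Q x → P x) → Any P xs → firstOr d P? xs ≡ firstOr e Q? xs
firstOr-cong P? Q? (x ∷ xs) P⇒Q Q⇒P any with P? x | Q? x | any
... | yes px | yes qx | _         = refl
... | yes px | no ¬qx | _         = contradiction (P⇒Q px) ¬qx
... | no ¬px | yes qx | _         = contradiction (Q⇒P qx) ¬px
... | no ¬px | no ¬qx | here px   = contradiction px ¬px
... | no ¬px | no ¬qx | there any′ = firstOr-cong P? Q? xs P⇒Q Q⇒P any′

toList-pointwise⁻ : ∀ {R : A → B → Set} {n} {xs : Vec A n} {ys : Vec B n} →
  Pointwise R (toList xs) (toList ys) → VecPointwise.Pointwise R xs ys
toList-pointwise⁻ {xs = []}     {[]}     []       = []
toList-pointwise⁻ {xs = _ ∷ _}  {_ ∷ _}  (r ∷ rs) = r ∷ toList-pointwise⁻ rs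

replicate⁻ : ∀ {P : A → Set} {n d} → n ≢ 0 → VecAll.All P (replicate n d) → P d
replicate⁻ {n = zero}  n≢0 _       = contradiction refl n≢0
replicate⁻ {n = suc n} _   (p ∷ _) = p

module _ {S : Signature} where
  open Signature S

  -- Subterm closure and the fixed point

  Closed : List (Term S) → Set
  Closed T = ∀ {f us} → node f us ∈ T → VecAll.All (_∈ T) us

  collect-acc : ∀ {n t} (ts : Vec (Term S) n) {acc} → t ∈ acc → t ∈ collect ts acc
  collect-acc []               t∈ = t∈
  collect-acc (node f us ∷ ts) t∈ = collect-acc ts (collect-acc us (there t∈))

  collect-∈ : ∀ {n} (ts : Vec (Term S) n) {acc} → VecAll.All (_∈ collect ts acc) ts
  collect-∈ []               = []
  collect-∈ (node f us ∷ ts) = collect-acc ts (collect-acc us (here refl)) ∷ collect-∈ ts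

  -- `acc` cannot be assumed closed in the induction: a node enters the accumulator before its
  -- arguments do.
  collect-children : ∀ {n f us} (ts : Vec (Term S) n) {acc} → node f us ∈ collect ts acc →
    node f us ∈ acc ⊎ VecAll.All (_∈ collect ts acc) us
  collect-children []               t∈ = inj₁ t∈
  collect-children (node g vs ∷ ts) t∈ with collect-children ts t∈
  ... | inj₂ us∈ = inj₂ us∈
  ... | inj₁ t∈′ with collect-children vs t∈′
  ...   | inj₂ us∈           = inj₂ (VecAll.map (collect-acc ts) us∈)
  ...   | inj₁ (here refl)   = inj₂ (VecAll.map (collect-acc ts) (collect-∈ vs))
  ...   | inj₁ (there t∈acc) = inj₁ t∈acc

  closed-collect : ∀ {n} (ts : Vec (Term S) n) {acc} → Closed acc → Closed (collect ts acc)
  closed-collect ts closed t∈ with collect-children ts t∈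
  ... | inj₁ t∈acc = VecAll.map (collect-acc ts) (closed t∈acc)
  ... | inj₂ us∈   = us∈

  closed-constants : Closed constants
  closed-constants t∈ with find (∈-concatMap⁻ (λ f → map (node f) (vectors [] (arity f))) {xs = allFin symbols} t∈)
  ... | f , _ , t∈f with ∈-map⁻ (node f) t∈f
  ... | us , us∈ , refl = VecAll.map (λ ()) (∈-vectors⁻ [] us∈)

  constants-∈ : ∀ f ts → arity f ≡ 0 → node f ts ∈ constants
  constants-∈ f ts arity≡0 = ∈-concatMap⁺ (λ f → map (node f) (vectors [] (arity f)))
    (lose (∈-tabulate⁺ f) (∈-map⁺ (node f) (∈-vectors⁺ (empty ts arity≡0))))
    where
    empty : ∀ {n} (ts : Vec (Term S) n) → n ≡ 0 → VecAll.All (_∈ []) ts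
    empty [] _ = []

  private
    collectEquation : List (Term S) → Equation S → List (Term S)
    collectEquation acc e = collect (proj₁ e ∷ proj₂ e ∷ []) acc

    subterms-acc : ∀ {t} Γ {acc} → t ∈ acc → t ∈ foldl collectEquation acc Γ
    subterms-acc []      t∈ = t∈
    subterms-acc (e ∷ Γ) t∈ = subterms-acc Γ (collect-acc (proj₁ e ∷ proj₂ e ∷ []) t∈)

  constants⊆subterms : ∀ {t} Γ → t ∈ constants → t ∈ subterms Γ
  constants⊆subterms Γ = subterms-acc Γ

  closed-subterms : ∀ Γ → Closed (subterms Γ)
  closed-subterms Γ = go Γ closed-constants
    where
    go : ∀ Γ {acc} → Closed acc → Closed (foldl collectEquation acc Γ)
    go []      closed = closed
    go (e ∷ Γ) closed = go Γ (closed-collect (proj₁ e ∷ proj₂ e ∷ []) closed)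

  equation⊆subterms : ∀ {p q} Γ → (p , q) ∈ Γ → p ∈ subterms Γ × q ∈ subterms Γ
  equation⊆subterms Γ = go
    where
    go : ∀ {p q Γ acc} → (p , q) ∈ Γ → p ∈ foldl collectEquation acc Γ × q ∈ foldl collectEquation acc Γ
    go {p} {q} {_ ∷ Γ} {acc} (here refl) with collect-∈ (p ∷ q ∷ []) {acc}
    ... | p∈ ∷ q∈ ∷ [] = subterms-acc Γ p∈ , subterms-acc Γ q∈
    go (there e∈) = go e∈

  -- Each derivation step before the fixed point lengthens the list, and
  -- derived lists are sublists of reverse U.
  derive-saturate : ∀ Γ U → derive Γ U (saturate Γ U) ≡ saturate Γ U
  derive-saturate Γ U = go U [] never (≡.sym (filter-none never (All.universal (λ _ ()) (reverse U))))
                           (inj₂ (≤-reflexive (length-reverse U)))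
    where
    D = derive Γ U
    -- The empty starting list is the filter by a predicate that never holds, so every stage is a
    -- filter of `reverse U`.
    never : ∀ (e : Equation S) → Dec ⊥
    never _ = no id
    grows? : ∀ R {P : Equation S → Set} (P? : ∀ e → Dec (P e)) → R ≡ filter P? (reverse U) →
      D R ≡ R ⊎ length R < length (D R)
    grows? R P? eq with length (D R) ≤? length R
    ... | no  ≰R = inj₂ (≰⇒> ≰R)
    ... | yes ≤R = inj₁ (≡.sym (≡.trans eq (filter-saturated P? (derivable? Γ R) (reverse U)
        (λ e∈ pe → inj₁ (subst (_ ∈_) (≡.sym eq) (∈-filter⁺ P? e∈ pe)))
        (subst (λ R′ → length (D R) ≤ length R′) eq ≤R))))
    go : ∀ es R {P : Equation S → Set} (P? : ∀ e → Dec (P e)) → R ≡ filter P? (reverse U) →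
      D R ≡ R ⊎ length (reverse U) ≤ length R + length es →
      D (foldl (λ R _ → D R) R es) ≡ foldl (λ R _ → D R) R es
    go [] R P? eq (inj₁ fixed) = fixed
    go [] R P? eq (inj₂ full) with grows? R P? eq
    ... | inj₁ fixed = fixed
    ... | inj₂ R<DR  = contradiction
      (≤-trans R<DR (≤-trans (length-filter (derivable? Γ R) (reverse U)) (≤-trans full (≤-reflexive (+-identityʳ _)))))
      (<-irrefl refl)
    go (e ∷ es) R P? eq progress = go es (D R) (derivable? Γ R) refl (advance progress)
      where
      advance : D R ≡ R ⊎ length (reverse U) ≤ length R + suc (length es) →
        D (D R) ≡ D R ⊎ length (reverse U) ≤ length (D R) + length es
      advance (inj₁ fixed) = inj₁ (≡.cong D fixed)
      advance (inj₂ bound) with grows? R P? eq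
      ... | inj₁ fixed = inj₁ (≡.cong D fixed)
      ... | inj₂ R<DR  = inj₂ (≤-trans bound (≤-trans (≤-reflexive (+-suc (length R) _)) (+-monoˡ-≤ _ R<DR)))

  -- By the fixed point equation the result is itself a filter of `reverse U`; the closure property
  -- below is read off in the same way.
  saturate-⊆ : ∀ Γ U {e} → e ∈ saturate Γ U → e ∈ U
  saturate-⊆ Γ U e∈ = reverse⁻ (proj₁ (∈-filter⁻ (derivable? Γ (saturate Γ U)) {xs = reverse U}
    (subst (_ ∈_) (≡.sym (derive-saturate Γ U)) e∈)))

  saturate-derivable : ∀ Γ U {e} → e ∈ U → Derivable Γ (saturate Γ U) e → e ∈ saturate Γ U
  saturate-derivable Γ U e∈ d = subst (_ ∈_) (derive-saturate Γ U)
    (∈-filter⁺ (derivable? Γ (saturate Γ U)) (reverse⁺ e∈) d)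

  -- Soundness of the saturation

  module _ (Γ : Equations S) where
    private
      axioms = Equations.list Γ

    Sound : List (Equation S) → Set
    Sound R = ∀ {t u} → (t , u) ∈ R → Γ ⊢ t ≈ u

    matches-sound : ∀ {R f ts} → Sound R → ∀ v → Matches R (f , toList ts) v → Γ ⊢ node f ts ≈ v
    matches-sound {ts = ts} sound (node f us) (refl , ps) =
      cong (VecPointwise.map sound (toList-pointwise⁻ ps))

    derivable-sound : ∀ {R} → Sound R → ∀ {t u} → Derivable axioms R (t , u) → Γ ⊢ t ≈ u
    derivable-sound sound (inj₁ t~u)                      = sound t~u
    derivable-sound sound (inj₂ (inj₁ refl))              = refl
    derivable-sound sound (inj₂ (inj₂ (inj₁ t≡u)))        = axiom t≡u
    derivable-sound sound {node f ts} {u} (inj₂ (inj₂ (inj₂ (inj₁ m)))) = matches-sound sound u m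
    derivable-sound sound (inj₂ (inj₂ (inj₂ (inj₂ any)))) with find any
    ... | (v , _) , v~t , refl , v~u = trans (sym (sound v~t)) (sound v~u)

    saturate-sound : ∀ U → Sound (saturate axioms U)
    saturate-sound U = go U (λ ())
      where
      go : ∀ es {R} → Sound R → Sound (foldl (λ R _ → derive axioms U R) R es)
      go []       sound = sound
      go (e ∷ es) {R} sound = go es λ e∈ →
        derivable-sound sound (proj₂ (∈-filter⁻ (derivable? axioms R) {xs = reverse U} e∈))

  tower : ∀ f → Term S → ℕ → Term S
  tower f d zero    = d
  tower f d (suc k) = node f (replicate (arity f) (tower f d k))

  -- Positive arity puts at least one copy of each level under the next. Size thus separates the
  -- levels.
  ∣tower∣-mono-< : ∀ {f d} → arity f ≢ 0 → ∀ {i j} → i < j → ∣ tower f d i ∣ < ∣ tower f d j ∣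
  ∣tower∣-mono-< {f} {d} n≢0 {i} {suc j} (s≤s i≤j) = s≤s (≤-trans (grow i≤j) (replicated (arity f) n≢0))
    where
    replicated : ∀ n {t : Term S} → n ≢ 0 → ∣ t ∣ ≤ ∣ replicate n t ∣*
    replicated zero    n≢0 = contradiction refl n≢0
    replicated (suc n) _   = m≤m+n _ _
    grow : i ≤ j → ∣ tower f d i ∣ ≤ ∣ tower f d j ∣
    grow i≤j with m≤n⇒m<n∨m≡n i≤j
    ... | inj₁ i<j  = <⇒≤ (∣tower∣-mono-< {f} {d} n≢0 i<j)
    ... | inj₂ refl = ≤-refl

  -- Normal forms

  -- The normal form argument sees `T` and `R` only through these properties.
  record Saturated (Γ : Equations S) (T : List (Term S)) (R : List (Equation S)) : Set where
    field
      children   : Closed T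
      constants∈ : ∀ f ts → arity f ≡ 0 → node f ts ∈ T
      axioms∈    : ∀ {p q} → (p , q) ∈ Equations.list Γ → p ∈ T × q ∈ T
      related∈   : ∀ {t u} → (t , u) ∈ R → t ∈ T × u ∈ T
      derivable  : ∀ {t u} → t ∈ T → u ∈ T → Derivable (Equations.list Γ) R (t , u) → (t , u) ∈ R
      sound      : Sound Γ R

  congruence-saturated : ∀ Γ → Saturated Γ (subterms (Equations.list Γ)) (congruence (Equations.list Γ))
  congruence-saturated Γ = record
    { children   = closed-subterms axioms
    ; constants∈ = λ f ts eq → constants⊆subterms axioms (constants-∈ f ts eq)
    ; axioms∈    = equation⊆subterms axioms
    ; related∈   = λ e∈ → ∈-pairs⁻ T T (saturate-⊆ axioms (pairs T T) e∈)
    ; derivable  = λ t∈ u∈ → saturate-derivable axioms (pairs T T) (∈-pairs⁺ t∈ u∈)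
    ; sound      = saturate-sound Γ (pairs T T)
    }
    where
    axioms = Equations.list Γ
    T      = subterms axioms

  module _ {Γ : Equations S} {T : List (Term S)} {R : List (Equation S)} (saturated : Saturated Γ T R) where
    open Saturated saturated

    infix 4 _~_
    _~_ : Term S → Term S → Set
    t ~ u = (t , u) ∈ R

    ~-refl : ∀ {t} → t ∈ T → t ~ t
    ~-refl t∈ = derivable t∈ t∈ (inj₂ (inj₁ refl))

    ~-euclidean : ∀ {t u v} → v ~ t → v ~ u → t ~ u
    ~-euclidean v~t v~u = derivable (proj₂ (related∈ v~t)) (proj₂ (related∈ v~u))
      (inj₂ (inj₂ (inj₂ (inj₂ (lose v~t (refl , v~u))))))

    ~-sym : ∀ {t u} → t ~ u → u ~ t
    ~-sym t~u = ~-euclidean t~u (~-refl (proj₁ (related∈ t~u)))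

    ~-trans : ∀ {t u v} → t ~ u → u ~ v → t ~ v
    ~-trans t~u u~v = ~-euclidean (~-sym t~u) u~v

    ~-axiom : ∀ {p q} → (p , q) ∈ Equations.list Γ → p ~ q
    ~-axiom e∈ = derivable (proj₁ p,q∈) (proj₂ p,q∈) (inj₂ (inj₂ (inj₁ e∈)))
      where p,q∈ = axioms∈ e∈

    Matching : Term S → Term S → Set
    Matching t v = Matches R (view t) v

    ~-matching : ∀ {t v} → t ∈ T → v ∈ T → Matching t v → t ~ v
    ~-matching t∈ v∈ m = derivable t∈ v∈ (inj₂ (inj₂ (inj₂ (inj₁ m))))

    -- The arguments of `v` and `w` are related through those of `t`, so the congruence rule, under
    -- which `R` is closed inside `T`, applies.
    matching-unique : ∀ {t v w} → v ∈ T → w ∈ T → Matching t v → Matching t w → v ~ w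
    matching-unique {node f ts} {node g us} {node h vs} v∈ w∈ (refl , ts~us) (refl , ts~vs) =
      ~-matching v∈ w∈ (refl , pointwise ts~us ts~vs)
      where
      pointwise : ∀ {ts us vs} → Pointwise _~_ ts us → Pointwise _~_ ts vs → Pointwise _~_ us vs
      pointwise []       []       = []
      pointwise (p ∷ ps) (q ∷ qs) = ~-euclidean p q ∷ pointwise ps qs

    -- Extends `_~_` on the left to applications that lie outside `T` but have their arguments in
    -- it.
    Equals : Term S → Term S → Set
    Equals t w = Any (λ v → Matching t v × v ~ w) T

    equals? : ∀ t w → Dec (Equals t w)
    equals? t w = any? (λ v → matches? R (view t) v ×-dec (v , w) ∈? R) T

    -- Scanning `T` in a fixed order makes the choice of representative canonical; the default
    -- leaves an application alone when it equals no member of `T`.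
    reduce : Term S → Term S
    reduce t = firstOr t (equals? t) T

    mutual
      nf : Term S → Term S
      nf (node f ts) = reduce (node f (nf* ts))

      nf* : ∀ {n} → Vec (Term S) n → Vec (Term S) n
      nf* []       = []
      nf* (t ∷ ts) = nf t ∷ nf* ts

    equals : ∀ {t v} → v ∈ T → Matching t v → Equals t v
    equals v∈ m = lose v∈ (m , ~-refl v∈)

    equals-unique : ∀ {t v w} → Equals t v → Equals t w → v ~ w
    equals-unique {t} p q with find p | find q
    ... | v′ , v′∈ , m , v′~v | w′ , w′∈ , m′ , w′~w =
      ~-euclidean v′~v (~-trans (matching-unique {t} v′∈ w′∈ m m′) w′~w)

    equals-~ : ∀ {t v w} → Equals t v → v ~ w → Equals t w
    equals-~ p v~w = Any.map (λ (m , u~v) → m , ~-trans u~v v~w) p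

    matching-reduce : ∀ {t v} → v ∈ T → Matching t v → v ~ reduce t
    matching-reduce {t} v∈ m =
      equals-unique {t} (equals {t} v∈ m) (proj₁ (firstOr-satisfies (equals? t) T (lose v∈ (equals {t} v∈ m))))

    mutual
      -- The arguments of `t` are in `T` and related to their normal forms, so `t` itself matches
      -- the application to be reduced and the search in `reduce` succeeds.
      nf-~ : ∀ t → t ∈ T → t ~ nf t
      nf-~ (node f ts) t∈ = matching-reduce t∈ (nf-matching f ts t∈)

      nf-matching : ∀ f ts → node f ts ∈ T → Matching (node f (nf* ts)) (node f ts)
      nf-matching f ts t∈ = refl , nf*-~ ts (children t∈)

      nf*-~ : ∀ {n} (ts : Vec (Term S) n) → VecAll.All (_∈ T) ts → Pointwise _~_ (toList (nf* ts)) (toList ts)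
      nf*-~ []       []          = []
      nf*-~ (t ∷ ts) (t∈ ∷ ts∈)  = ~-sym (nf-~ t t∈) ∷ nf*-~ ts ts∈

    -- A member of `T` equal to one of the two applications with normalized arguments is equal to
    -- the other, so both searches accept the same members and stop at the same one.
    nf-cong-~ : ∀ {t u} → t ~ u → nf t ≡ nf u
    nf-cong-~ {t@(node f ts)} {u@(node g us)} t~u =
      firstOr-cong (equals? t′) (equals? u′) T
        (λ p → equals-~ {u′} (equals {u′} u∈ mu) (~-trans (~-sym t~u) (equals-unique {t′} (equals {t′} t∈ mt) p)))
        (λ p → equals-~ {t′} (equals {t′} t∈ mt) (~-trans t~u (equals-unique {u′} (equals {u′} u∈ mu) p)))
        (lose t∈ (equals {t′} t∈ mt))
      where
      t′ = node f (nf* ts)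
      u′ = node g (nf* us)
      t∈ = proj₁ (related∈ t~u)
      u∈ = proj₂ (related∈ t~u)
      mt = nf-matching f ts t∈
      mu = nf-matching g us u∈

    mutual
      -- Equality of normal forms is a congruence by the definition of `nf`. Only axioms carry
      -- content, and these are pairs of `R`.
      nf-complete : ∀ {t u} → Γ ⊢ t ≈ u → nf t ≡ nf u
      nf-complete (axiom e∈)  = nf-cong-~ (~-axiom e∈)
      nf-complete refl        = refl
      nf-complete (sym p)     = ≡.sym (nf-complete p)
      nf-complete (trans p q) = ≡.trans (nf-complete p) (nf-complete q)
      nf-complete (cong {f} ps) = ≡.cong (reduce ∘ node f) (nf*-complete ps)

      nf*-complete : ∀ {n} {ts us : Vec (Term S) n} → VecPointwise.Pointwise (Γ ⊢_≈_) ts us → nf* ts ≡ nf* us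
      nf*-complete []       = refl
      nf*-complete (p ∷ ps) = ≡.cong₂ _∷_ (nf-complete p) (nf*-complete ps)

    reduce-sound : ∀ t → Γ ⊢ t ≈ reduce t
    reduce-sound t@(node f ts) with any? (equals? t) T
    ... | no ¬any = subst (Γ ⊢ t ≈_) (≡.sym (firstOr-default (equals? t) T ¬any)) refl
    ... | yes any with find (proj₁ (firstOr-satisfies (equals? t) T any))
    ...   | v , v∈ , m , v~ = trans (matches-sound Γ sound v m) (sound v~)

    mutual
      nf-sound : ∀ t → Γ ⊢ t ≈ nf t
      nf-sound (node f ts) = trans (cong (nf*-sound ts)) (reduce-sound (node f (nf* ts)))

      nf*-sound : ∀ {n} (ts : Vec (Term S) n) → VecPointwise.Pointwise (Γ ⊢_≈_) ts (nf* ts)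
      nf*-sound []       = []
      nf*-sound (t ∷ ts) = nf-sound t ∷ nf*-sound ts

    nf-idempotent : ∀ t → nf (nf t) ≡ nf t
    nf-idempotent t = ≡.sym (nf-complete (nf-sound t))

    -- Totality implies finiteness

    module _ (total : Total R T) where

      mutual
        nf-∈ : ∀ t → nf t ∈ T
        nf-∈ (node f ts) with find (All.lookup (All.lookup total (∈-tabulate⁺ f)) (∈-vectors⁺ (nf*-∈ ts)))
        ... | v , v∈ , m = proj₂ (firstOr-satisfies (equals? t) T (lose v∈ (equals {t} v∈ m)))
          where t = node f (nf* ts)

        nf*-∈ : ∀ {n} (ts : Vec (Term S) n) → VecAll.All (_∈ T) (nf* ts)
        nf*-∈ []       = []
        nf*-∈ (t ∷ ts) = nf-∈ t ∷ nf*-∈ ts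

      -- The classes are enumerated by their normal forms. Removing duplicates makes the enumeration
      -- injective, because distinct normal forms are incongruent.
      total⇒finite : Finite (𝓕 Γ)
      total⇒finite = length normals , record
        { to        = List.lookup normals
        ; cong      = λ { refl → refl }
        ; bijective = (λ {i} {j} i≈j → lookup-injective (deduplicate-! _≟_ (map nf T)) i j
                        (≡.trans (≡.sym (normal i)) (≡.trans (nf-complete i≈j) (normal j))))
                    , λ t → Any.index (nf-∈-normals t) , λ { refl →
                        subst (Γ ⊢_≈ t) (lookup-index (nf-∈-normals t)) (sym (nf-sound t)) }
        }
        where
        normals : List (Term S)
        normals = deduplicate _≟_ (map nf T)
        normal : ∀ i → nf (List.lookup normals i) ≡ List.lookup normals i
        normal i with ∈-map⁻ nf (∈-deduplicate⁻ _≟_ (map nf T) (∈-lookup {xs = normals} i))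
        ... | t , _ , eq = ≡.trans (≡.cong nf eq) (≡.trans (nf-idempotent t) (≡.sym eq))
        -- Totality puts `nf t` into `T`, and by idempotence it is its own image under `nf`.
        nf-∈-normals : ∀ t → nf t ∈ normals
        nf-∈-normals t = ∈-deduplicate⁺ _≟_ (subst (_∈ map nf T) (nf-idempotent t) (∈-map⁺ nf (nf-∈ t)))

    -- Failure of totality implies infinity

    Outside : Term S → Set
    Outside d = ¬ (d ∈ T) × nf d ≡ d

    unmatched-reduce : ∀ {t} → ¬ Any (Matching t) T → reduce t ≡ t
    unmatched-reduce {t} ¬m = firstOr-default (equals? t) T
      λ any → let _ , _ , p = find any ; v , v∈ , m , _ = find p in ¬m (lose v∈ m)

    -- If the new term were in `T`, so would its argument `d` be, by closure under arguments. If it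
    -- matched a member of `T`, then `d` would be related to something and again lie in `T`. Hence
    -- it is not reduced.
    outside-suc : ∀ {f d} → arity f ≢ 0 → Outside d → Outside (node f (replicate (arity f) d))
    outside-suc {f} {d} n≢0 (d∉ , nf-d) =
      (λ t∈ → d∉ (replicate⁻ n≢0 (children t∈))) ,
      ≡.trans (≡.cong (reduce ∘ node f) (nf*-replicate (arity f)))
        (unmatched-reduce {node f (replicate (arity f) d)} λ any → let v , _ , _ , ps = find any in
          d∉ (head-∈ n≢0 ps))
      where
      nf*-replicate : ∀ n → nf* (replicate n d) ≡ replicate n d
      nf*-replicate zero    = refl
      nf*-replicate (suc n) = ≡.cong₂ _∷_ nf-d (nf*-replicate n)
      head-∈ : ∀ {n ts} → n ≢ 0 → Pointwise _~_ (toList (replicate n d)) ts → d ∈ T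
      head-∈ {zero}  n≢0 _       = contradiction refl n≢0
      head-∈ {suc n} _   (p ∷ _) = proj₁ (related∈ p)

    outside-tower : ∀ {f d} → arity f ≢ 0 → Outside d → ∀ k → Outside (tower f d k)
    outside-tower n≢0 out zero    = out
    outside-tower n≢0 out (suc k) = outside-suc n≢0 (outside-tower n≢0 out k)

    -- By the pigeonhole principle two of `n + 1` levels share one of `n` classes. Both are normal,
    -- hence they coincide, against their sizes.
    outside⇒infinite : ∀ {f d} → arity f ≢ 0 → Outside d → ¬ Finite (𝓕 Γ)
    outside⇒infinite {f} {d} n≢0 out (n , bij) with pigeonhole (n<1+n n) (preimage ∘ tower f d ∘ toℕ)
      where preimage = λ t → proj₁ (Bijection.surjective bij t)
    ... | i , j , i<j , eq = <⇒≢ (∣tower∣-mono-< n≢0 i<j) (≡.cong ∣_∣ towers≡)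
      where
      image≈ : ∀ t → Γ ⊢ Bijection.to bij (proj₁ (Bijection.surjective bij t)) ≈ t
      image≈ t = proj₂ (Bijection.surjective bij t) refl
      towers≡ : tower f d (toℕ i) ≡ tower f d (toℕ j)
      towers≡ = ≡.trans (≡.sym (proj₂ (outside-tower n≢0 out (toℕ i))))
        (≡.trans (nf-complete (trans (sym (image≈ _))
          (subst (λ k → Γ ⊢ Bijection.to bij k ≈ tower f d (toℕ j)) (≡.sym eq) (image≈ _))))
        (proj₂ (outside-tower n≢0 out (toℕ j))))

    -- As `ts` and `nf* ts` are related, normalizing the arguments creates no match. The resulting
    -- term is not in `T`, for there it would match `node f ts`; it is normal because it is the
    -- normal form of `node f ts`.
    unmatched-outside : ∀ {f ts} → VecAll.All (_∈ T) ts → ¬ Any (Matches R (f , toList ts)) T →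
      Outside (node f (nf* ts))
    unmatched-outside {f} {ts} ts∈ ¬m = d∉ , ≡.trans (≡.cong nf (≡.sym nf-t)) (≡.trans (nf-idempotent t) nf-t)
      where
      t = node f ts
      d = node f (nf* ts)
      ts~nf : Pointwise _~_ (toList ts) (toList (nf* ts))
      ts~nf = Pointwise.symmetric ~-sym (nf*-~ ts ts∈)
      ¬m′ : ¬ Any (Matching d) T
      ¬m′ any = ¬m (Any.map (λ { (eq , ps) → eq , Pointwise.transitive ~-trans ts~nf ps }) any)
      nf-t : nf t ≡ d
      nf-t = unmatched-reduce {d} ¬m′
      d∉ : ¬ (d ∈ T)
      d∉ d∈ = ¬m (lose d∈ (refl , ts~nf))

    -- Contraposition is constructive because `Total` is decidable: a failed check yields an actual
    -- unmatched application.
    finite⇒total : Finite (𝓕 Γ) → Total R T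
    finite⇒total finite with total? R T
    ... | yes total = total
    ... | no ¬total with find (¬All⇒Any¬ (λ f → all? (λ ts → any? (matches? R (f , toList ts)) T) (vectors T (arity f))) _ ¬total)
    ...   | f , _ , ¬all with find (¬All⇒Any¬ (λ ts → any? (matches? R (f , toList ts)) T) _ ¬all)
    ...     | ts , ts∈ , ¬m = contradiction finite
      (outside⇒infinite arity≢0 (unmatched-outside (∈-vectors⁻ T ts∈) ¬m))
      where
      arity≢0 : arity f ≢ 0
      -- A constant is in `T` and matches itself, so an unmatched application has positive arity.
      arity≢0 eq = ¬m (lose (constants∈ f ts eq) (refl , reflexive (∈-vectors⁻ T ts∈)))
        where
        reflexive : ∀ {n} {ts : Vec (Term S) n} → VecAll.All (_∈ T) ts → Pointwise _~_ (toList ts) (toList ts)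
        reflexive []         = []
        reflexive (t∈ ∷ ts∈) = ~-refl t∈ ∷ reflexive ts∈

  -- The decision procedure and the size of the encoding

  finite? : ∀ Γ → Dec (Finite (𝓕 Γ))
  finite? Γ = map′ (total⇒finite saturated) (finite⇒total saturated)
    (total? (congruence (Equations.list Γ)) (subterms (Equations.list Γ)))
    where saturated = congruence-saturated Γ

  encode-equations : ∀ Γ → encodeEquations {S} Γ ≡ encode (list equation) (Equations.list Γ)
  encode-equations Γ = go (Equations.list Γ)
    where
    go : ∀ es → encodeList (map (λ (p , q) → encodeTerm p ∙ encodeTerm q) es) ≡ encode (list equation) es
    go []       = refl
    go (e ∷ es) = ≡.cong (_ ∙_) (go es)

  private
    -- A node accounts for its unary numeral, of weight below `symbols`, the cell joining it to its
    -- arguments, and one cell of the surrounding list or pair.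
    k = 2 + symbols

  mutual
    weight-term : ∀ t → suc (weight (encodeTerm {S} t)) ≤ k * ∣ t ∣
    weight-term (node f ts) = begin
      2 + (weight (encodeℕ (toℕ f)) + weight (encodeTerms ts))
        ≤⟨ +-monoʳ-≤ 2 (+-mono-≤ (≤-trans (≤-reflexive (weight-encodeℕ (toℕ f))) (<⇒≤ (toℕ<n f))) (weight-terms ts)) ⟩
      k + k * ∣ ts ∣*     ≡⟨ *-suc k ∣ ts ∣* ⟨
      k * suc ∣ ts ∣*     ∎
      where open ≤-Reasoning

    weight-terms : ∀ {n} (ts : Vec (Term S) n) → weight (encodeTerms ts) ≤ k * ∣ ts ∣*
    weight-terms []       = z≤n
    weight-terms (t ∷ ts) = ≤-trans (+-mono-≤ (weight-term t) (weight-terms ts))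
      (≤-reflexive (≡.sym (*-distribˡ-+ k ∣ t ∣ ∣ ts ∣*)))

  weight-equations : ∀ Γ → weightOf (list equation) (Equations.list Γ) ≤ k * size Γ
  weight-equations Γ = go (Equations.list Γ)
    where
    open ≤-Reasoning
    go : ∀ es → weightOf (list equation) es ≤ k * foldr _+_ 0 (map (λ (p , q) → ∣ p ∣ + ∣ q ∣) es)
    go []       = z≤n
    go ((p , q) ∷ es) = begin
      -- An equation has two cells of its own, its pair and its list cell; one is charged to each
      -- side.
      suc (suc (wp + wq) + rest)     ≡⟨ ≡.cong (_+ rest) (≡.cong suc (+-suc wp wq)) ⟨
      suc wp + suc wq + rest         ≤⟨ +-mono-≤ (+-mono-≤ (weight-term p) (weight-term q)) (go es) ⟩
      k * ∣ p ∣ + k * ∣ q ∣ + k * n   ≡⟨ ≡.cong (_+ k * n) (*-distribˡ-+ k ∣ p ∣ ∣ q ∣) ⟨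
      k * (∣ p ∣ + ∣ q ∣) + k * n     ≡⟨ *-distribˡ-+ k (∣ p ∣ + ∣ q ∣) n ⟨
      k * (∣ p ∣ + ∣ q ∣ + n)         ∎
      where
      wp = weight (encodeTerm p)
      wq = weight (encodeTerm q)
      rest = weightOf (list equation) es
      n = foldr _+_ 0 (map (λ (p , q) → ∣ p ∣ + ∣ q ∣) es)

polynomialTimeDecidable : ∀ {A : Set} {σ : Type} {encodeA : A → Tree} {sizeA : A → ℕ} {P : A → Set}
  (input : A → El σ) (P? : ∀ x → Dec (P x)) {decide : El σ → Bool} → PolyTime σ bool decide →
  (∀ x → encodeA x ≡ encode σ (input x)) → (∀ x → decide (input x) ≡ does (P? x)) →
  ∀ k → (∀ x → weightOf σ (input x) ≤ k * sizeA x) →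
  PolynomialTimeDecidable encodeA sizeA P
polynomialTimeDecidable {sizeA = sizeA} input P? pdecide encode≡ decide≡ k weight≤ =
  -- The single auxiliary variable is the stack `Y`, initially empty.
  program 1 (code pdecide) , proj₁ monomial , proj₁ (proj₂ monomial) , λ x → P? x ,
  (let n , ⇓n , n≤ = runs pdecide (input x) nil in
   n , _ ,
   subst (λ t → ⟨ code pdecide , t ∷ nil ∷ [] ⟩⇓[ n ] _) (≡.sym (encode≡ x)) ⇓n ,
   ≡.cong encodeBool (decide≡ x) ,
   ≤-trans n≤ (≤-trans (eval-mono (time pdecide) (weight≤ x)) (proj₂ (proj₂ monomial) (sizeA x))))
  where
  open PolyTime
  monomial = eval≤monomial (time pdecide ∘ₚ (con k ⊛ var))

corollary3p11 : (S : Signature) → PolynomialTimeDecidable (encodeEquations {S}) size (λ Γ → Finite (𝓕 Γ))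
-- `refl` suffices for agreement of the booleans: `finite?` is obtained by `map′`, which keeps the
-- boolean of `total?`.
corollary3p11 S = polynomialTimeDecidable Equations.list finite? finiteᵖ encode-equations (λ _ → refl)
  (2 + Signature.symbols S) weight-equations
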